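{- For any real-valued function $r(N)$ of the positive integer $N$ with $\lim_{N\to\infty}r(N)=\infty$ we have $$E_N^{rat-sym}\ge 2^{N/2-r(N)+o(1)}.$$ Moreover, we have $$E_N^{2-adic-sym}\ge \frac{N}{2}-\log(N)+o(1).$$ Here $o(1)$ denotes a function of $N$ tending to $0$ as $N\to\infty$ (in the first bound it may depend on the function $r$).
   Context: For a binary vector $\mathcal{S}_N=(s_0,\ldots,s_{N-1})\in\{0,1\}^N$, the $N$th rational complexity is $$\Lambda(\mathcal{S}_N)=\min\left\{\max\{q,|f|\}: q\sum_{n=0}^{N-1}s_n2^n\equiv f\bmod 2^N,\ q>0 \mbox{ odd}\right\},$$ where $q,f$ range over integers, and the $N$th 2-adic complexity is $\lambda(\mathcal{S}_N)=\log_2(\Lambda(\mathcal{S}_N))$. The reverse of $\mathcal{S}_N$ is $\mathcal{S}_N^{rev}=(s_{N-1},s_{N-2},\ldots,s_0)$. For $N\ge 2$ put $\Lambda^{sym}(\mathcal{S}_N)=\min\{\Lambda(\mathcal{S}_N),\Lambda(\mathcal{S}_N^{rev})\}$ and $\lambda^{sym}(\mathcal{S}_N)=\min\{\lambda(\mathcal{S}_N),\lambda(\mathcal{S}_N^{rev})\}$. The expected values are $$E_N^{rat-sym}=\frac{1}{2^N}\sum_{\mathcal{S}_N\in\{0,1\}^N}\Lambda^{sym}(\mathcal{S}_N),\qquad E_N^{2-adic-sym}=\frac{1}{2^N}\sum_{\mathcal{S}_N\in\{0,1\}^N}\lambda^{sym}(\mathcal{S}_N).$$ $\log$ denotes the natural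 logarithm and $\log_2$ the logarithm in base $2$. -}

module Defs where

open import Algebra.Bundles using (CommutativeRing)
import Algebra.Properties.CommutativeSemiring.Exp as Exp
open import Data.Fin.Base using (Fin; toℕ)
open import Data.Integer.Base as ℤ using (ℤ; +_; -[1+_]; _⊖_)
import Data.Integer.Divisibility as ℤ
import Data.Integer.Properties as ℤ
open import Data.List.Base using (List; []; _∷_; allFin; cartesianProductWith; foldr; map)
open import Data.Nat.Base as ℕ using (ℕ; zero; suc)
open import Data.Nat.Coprimality using (1-coprimeTo)
import Data.Nat.Divisibility as ℕ
import Data.Nat.Properties as ℕ
open import Data.Product using (Σ; ∃; ∃₂; _×_; _,_; proj₁; proj₂)
open import Data.Rational.Base hiding (∣_∣; floor; ceiling)
open import Data.Rational.Literals using (fromℤ)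
open import Data.Rational.Properties
import Data.Rational.Unnormalised.Properties as ℚᵘ
open import Data.Rational.Solver using (module +-*-Solver)
open import Data.Sum.Base as Sum using (_⊎_; inj₁; inj₂; [_,_]′)
open import Data.Vec.Base as Vec using (Vec; []; _∷_)
open import Relation.Binary.Definitions using (tri<; tri≈; tri>)
open import Relation.Unary using (Decidable)
open import Relation.Binary.PropositionalEquality
open import Relation.Nullary.Decidable.Core using (Dec; yes; no; from-yes; map′; _×-dec_; _⊎-dec_; ¬?)
open import Relation.Nullary.Negation.Core using (¬_; contradiction)

open Exp (CommutativeRing.commutativeSemiring +-*-commutativeRing)
  using (_^_; ^-homo-*; ^-assocʳ; ^-distrib-*)
open +-*-Solver using (solve; _:=_; _:+_; _:*_; :-_; con)

fromℕ : ℕ → ℚ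
fromℕ n = fromℤ (+ n)

2ℚ : ℚ
2ℚ = fromℕ 2

2^ℤ_ : ℤ → ℚ
2^ℤ (+ n)    = 2ℚ ^ n
2^ℤ -[1+ n ] = ½ ^ suc n

0<1 : 0ℚ < 1ℚ
0<1 = from-yes (0ℚ <? 1ℚ)

fromℕ-suc : ∀ n → fromℕ (suc n) ≡ 1ℚ + fromℕ n
fromℕ-suc n = sym (trans
  (cong (λ z → z / 1) (trans (cong (λ z → + 1 ℤ.+ z) (ℤ.*-identityʳ (+ n))) refl))
  (↥p/↧p≡p (fromℕ (suc n))))

fromℕ-≥0 : ∀ n → 0ℚ ≤ fromℕ n
fromℕ-≥0 n = nonNegative⁻¹ (fromℕ n)

<⇒0<- : ∀ {p q} → p < q → 0ℚ < q - p
<⇒0<- {p} {q} p<q = subst (_< q - p) (+-inverseʳ p) (+-monoˡ-< (- p) p<q)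

p<p+1 : ∀ p → p < p + 1ℚ
p<p+1 p = subst (_< p + 1ℚ) (+-identityʳ p) (+-monoʳ-< p 0<1)

p-1<p : ∀ p → p - 1ℚ < p
p-1<p p = subst (p - 1ℚ <_) (+-identityʳ p) (+-monoʳ-< p (from-yes (- 1ℚ <? 0ℚ)))

*-monoʳ : ∀ {r p q} → 0ℚ ≤ r → p ≤ q → r * p ≤ r * q
*-monoʳ {r} 0≤r = *-monoˡ-≤-nonNeg r {{nonNegative 0≤r}}

*-monoˡ : ∀ {r p q} → 0ℚ ≤ r → p ≤ q → p * r ≤ q * r
*-monoˡ {r} 0≤r = *-monoʳ-≤-nonNeg r {{nonNegative 0≤r}}

*-mono : ∀ {p q r s} → 0ℚ ≤ p → 0ℚ ≤ s → p ≤ q → r ≤ s → p * r ≤ q * s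
*-mono 0≤p 0≤s p≤q r≤s = ≤-trans (*-monoʳ 0≤p r≤s) (*-monoˡ 0≤s p≤q)

*-pos : ∀ {p q} → 0ℚ < p → 0ℚ < q → 0ℚ < p * q
*-pos {p} {q} 0<p 0<q = subst (_< p * q) (*-zeroʳ p) (*-monoʳ-<-pos p {{positive 0<p}} 0<q)

*-nonNeg : ∀ {p q} → 0ℚ ≤ p → 0ℚ ≤ q → 0ℚ ≤ p * q
*-nonNeg {p} {q} 0≤p 0≤q = subst (_≤ p * q) (*-zeroʳ p) (*-monoʳ 0≤p 0≤q)

*-cancelʳ : ∀ {p q} r → 0ℚ < r → p * r ≤ q * r → p ≤ q
*-cancelʳ r 0<r = *-cancelʳ-≤-pos r {{positive 0<r}}

^-pos : ∀ {p} n → 0ℚ < p → 0ℚ < p ^ n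
^-pos zero    0<p = 0<1
^-pos (suc n) 0<p = *-pos 0<p (^-pos n 0<p)

^-nonNeg : ∀ {p} n → 0ℚ ≤ p → 0ℚ ≤ p ^ n
^-nonNeg zero    0≤p = <⇒≤ 0<1
^-nonNeg (suc n) 0≤p = *-nonNeg 0≤p (^-nonNeg n 0≤p)

^-mono : ∀ {p q} n → 0ℚ ≤ p → p ≤ q → p ^ n ≤ q ^ n
^-mono zero    0≤p p≤q = ≤-refl
^-mono (suc n) 0≤p p≤q = *-mono 0≤p (^-nonNeg n (≤-trans 0≤p p≤q)) p≤q (^-mono n 0≤p p≤q)

^-mono-< : ∀ {p q} n .{{_ : ℕ.NonZero n}} → 0ℚ ≤ p → p < q → p ^ n < q ^ n
^-mono-< {p} {q} (suc n) 0≤p p<q = ≤-<-trans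
  (*-monoʳ 0≤p (^-mono n 0≤p (<⇒≤ p<q)))
  (*-monoˡ-<-pos (q ^ n) {{positive (^-pos n (≤-<-trans 0≤p p<q))}} p<q)

^-cancel : ∀ {p q} n .{{_ : ℕ.NonZero n}} → 0ℚ ≤ q → p ^ n ≤ q ^ n → p ≤ q
^-cancel {p} {q} n 0≤q pⁿ≤qⁿ with p ≤? q
... | yes p≤q = p≤q
... | no  p≰q = contradiction (<-≤-trans (^-mono-< n 0≤q (≰⇒> p≰q)) pⁿ≤qⁿ) (<-irrefl refl)

1≤^ : ∀ {p} n → 1ℚ ≤ p → 1ℚ ≤ p ^ n
1≤^ zero    1≤p = ≤-refl
1≤^ (suc n) 1≤p = *-mono (<⇒≤ 0<1) (≤-trans (<⇒≤ 0<1) (1≤^ n 1≤p)) 1≤p (1≤^ n 1≤p)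

1^ : ∀ n → 1ℚ ^ n ≡ 1ℚ
1^ zero    = refl
1^ (suc n) = trans (*-identityˡ _) (1^ n)

p≤∣↥p∣ : ∀ p → p ≤ fromℕ ℤ.∣ ↥ p ∣
p≤∣↥p∣ p@(mkℚ (+ n) d _) = *≤* (ℤ.*-monoˡ-≤-nonNeg (+ n) (ℤ.+≤+ (ℕ.s≤s ℕ.z≤n)))
p≤∣↥p∣ p@(mkℚ -[1+ n ] d _) = ≤-trans (nonPositive⁻¹ p) (fromℕ-≥0 (suc n))

archimedean : ∀ p {d} → 0ℚ < d → ∃ λ n → p ≤ fromℕ n * d
archimedean p {d} 0<d = n , (begin
  p               ≡⟨ *-identityʳ p ⟨
  p * 1ℚ          ≡⟨ cong (p *_) (*-inverseˡ d) ⟨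
  p * (1/ d * d)  ≡⟨ *-assoc p (1/ d) d ⟨
  p * 1/ d * d    ≤⟨ *-monoˡ (<⇒≤ 0<d) (p≤∣↥p∣ (p * 1/ d)) ⟩
  fromℕ n * d     ∎)
  where
  open ≤-Reasoning
  instance _ = >-nonZero 0<d
  n = ℤ.∣ ↥ (p * 1/ d) ∣

1≤2^ : ∀ n → 1ℚ ≤ 2ℚ ^ n
1≤2^ n = 1≤^ n (from-yes (1ℚ ≤? 2ℚ))

½^*2^ : ∀ n → ½ ^ n * 2ℚ ^ n ≡ 1ℚ
½^*2^ n = trans (sym (^-distrib-* ½ 2ℚ n)) (1^ n)

2^ℤ-pos : ∀ i → 0ℚ < 2^ℤ i
2^ℤ-pos (+ n)    = ^-pos n (from-yes (0ℚ <? 2ℚ))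
2^ℤ-pos -[1+ n ] = ^-pos (suc n) (from-yes (0ℚ <? ½))

2^ℤ-neg : ∀ n → 2^ℤ (ℤ.- (+ n)) ≡ ½ ^ n
2^ℤ-neg zero    = refl
2^ℤ-neg (suc n) = refl

2^ℤ-⊖ : ∀ m n → 2^ℤ (m ⊖ n) ≡ 2ℚ ^ m * ½ ^ n
2^ℤ-⊖ m       zero    = sym (*-identityʳ (2ℚ ^ m))
2^ℤ-⊖ zero    (suc n) = sym (*-identityˡ (½ ^ suc n))
2^ℤ-⊖ (suc m) (suc n) = begin
  2^ℤ (suc m ⊖ suc n)            ≡⟨ cong 2^ℤ_ (ℤ.[1+m]⊖[1+n]≡m⊖n m n) ⟩
  2^ℤ (m ⊖ n)                    ≡⟨ 2^ℤ-⊖ m n ⟩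
  2ℚ ^ m * ½ ^ n                 ≡⟨ *-identityˡ _ ⟨
  (2ℚ * ½) * (2ℚ ^ m * ½ ^ n)    ≡⟨ solve 4 (λ a b c d → (a :* b) :* (c :* d) := (a :* c) :* (b :* d)) refl 2ℚ ½ (2ℚ ^ m) (½ ^ n) ⟩
  (2ℚ * 2ℚ ^ m) * (½ * ½ ^ n)    ∎
  where open ≡-Reasoning

2^ℤ-homo-+ : ∀ i j → 2^ℤ (i ℤ.+ j) ≡ 2^ℤ i * 2^ℤ j
2^ℤ-homo-+ (+ m)    (+ n)    = ^-homo-* 2ℚ m n
2^ℤ-homo-+ (+ m)    -[1+ n ] = 2^ℤ-⊖ m (suc n)
2^ℤ-homo-+ -[1+ m ] (+ n)    = trans (2^ℤ-⊖ n (suc m)) (*-comm (2ℚ ^ n) (½ ^ suc m))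
2^ℤ-homo-+ -[1+ m ] -[1+ n ] = trans
  (cong (λ k → ½ ^ suc k) (sym (ℕ.+-suc m n)))
  (^-homo-* ½ (suc m) (suc n))

2^ℤ-^ : ∀ i n → (2^ℤ i) ^ n ≡ 2^ℤ (i ℤ.* + n)
2^ℤ-^ (+ m)    n = trans (^-assocʳ 2ℚ m n) (cong 2^ℤ_ (ℤ.pos-* m n))
2^ℤ-^ -[1+ m ] n = begin
  (½ ^ suc m) ^ n                ≡⟨ ^-assocʳ ½ (suc m) n ⟩
  ½ ^ (suc m ℕ.* n)              ≡⟨ 2^ℤ-neg (suc m ℕ.* n) ⟨
  2^ℤ (ℤ.- (+ (suc m ℕ.* n)))    ≡⟨ cong (λ i → 2^ℤ (ℤ.- i)) (ℤ.pos-* (suc m) n) ⟩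
  2^ℤ (ℤ.- (+ suc m ℤ.* + n))    ≡⟨ cong 2^ℤ_ (ℤ.neg-distribˡ-* (+ suc m) (+ n)) ⟩
  2^ℤ (-[1+ m ] ℤ.* + n)         ∎
  where open ≡-Reasoning

2^ℤ-mono : ∀ {i j} → i ℤ.≤ j → 2^ℤ i ≤ 2^ℤ j
2^ℤ-mono {i} {j} i≤j = begin
  2^ℤ i                              ≡⟨ *-identityʳ (2^ℤ i) ⟨
  2^ℤ i * 1ℚ                         ≤⟨ *-monoʳ (<⇒≤ (2^ℤ-pos i)) (1≤2^ ℤ.∣ j ℤ.- i ∣) ⟩
  2^ℤ i * 2^ℤ (+ ℤ.∣ j ℤ.- i ∣)      ≡⟨ cong (λ k → 2^ℤ i * 2^ℤ k) (ℤ.0≤i⇒+∣i∣≡i (ℤ.i≤j⇒0≤j-i i≤j)) ⟩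
  2^ℤ i * 2^ℤ (j ℤ.- i)              ≡⟨ 2^ℤ-homo-+ i (j ℤ.- i) ⟨
  2^ℤ (i ℤ.+ (j ℤ.- i))              ≡⟨ cong 2^ℤ_ (trans (ℤ.+-comm i _) (trans (ℤ.+-assoc j _ i) (trans (cong (λ k → j ℤ.+ k) (ℤ.+-inverseˡ i)) (ℤ.+-identityʳ j)))) ⟩
  2^ℤ j                              ∎
  where open ≤-Reasoning

2^ℤ-cancel : ∀ {i j} → 2^ℤ i ≤ 2^ℤ j → i ℤ.≤ j
2^ℤ-cancel {i} {j} h with i ℤ.≤? j
... | yes i≤j = i≤j
... | no  i≰j = contradiction
  (<-≤-trans
    (subst₂ _<_ (*-identityˡ (2^ℤ j)) (sym (2^ℤ-homo-+ (+ 1) j))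
      (*-monoˡ-<-pos (2^ℤ j) {{positive (2^ℤ-pos j)}} (from-yes (1ℚ <? 2^ℤ (+ 1)))))
    (≤-trans (2^ℤ-mono (ℤ.i<j⇒suc[i]≤j (ℤ.≰⇒> i≰j))) h))
  (<-irrefl refl)

-- For y > 0 these compare y with 2ᵖ: if p = m/n then y ≤ 2ᵖ iff yⁿ ≤ 2ᵐ.
infix 4 _≤2^_ _≥2^_

_≤2^_ _≥2^_ : ℚ → ℚ → Set
y ≤2^ p = y ^ ↧ₙ p ≤ 2^ℤ (↥ p)
y ≥2^ p = 2^ℤ (↥ p) ≤ y ^ ↧ₙ p

^-^-comm : ∀ y m n → (y ^ m) ^ n ≡ (y ^ n) ^ m
^-^-comm y m n = trans (^-assocʳ y m n) (trans (cong (y ^_) (ℕ.*-comm m n)) (sym (^-assocʳ y n m)))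

≥2^⇒≤2^⇒≤ : ∀ {y p r} → 0ℚ ≤ y → y ≥2^ p → y ≤2^ r → p ≤ r
≥2^⇒≤2^⇒≤ {y} {p@record{}} {r@record{}} 0≤y y≥ y≤ = *≤* (2^ℤ-cancel (begin
  2^ℤ (↥ p ℤ.* ↧ r)        ≡⟨ 2^ℤ-^ (↥ p) (↧ₙ r) ⟨
  2^ℤ (↥ p) ^ ↧ₙ r         ≤⟨ ^-mono (↧ₙ r) (<⇒≤ (2^ℤ-pos (↥ p))) y≥ ⟩
  (y ^ ↧ₙ p) ^ ↧ₙ r        ≡⟨ ^-^-comm y (↧ₙ p) (↧ₙ r) ⟩
  (y ^ ↧ₙ r) ^ ↧ₙ p        ≤⟨ ^-mono (↧ₙ p) (^-nonNeg (↧ₙ r) 0≤y) y≤ ⟩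
  2^ℤ (↥ r) ^ ↧ₙ p         ≡⟨ 2^ℤ-^ (↥ r) (↧ₙ p) ⟩
  2^ℤ (↥ r ℤ.* ↧ p)        ∎))
  where open ≤-Reasoning

2^-mono : ∀ p r → p ≤ r → 2^ℤ (↥ p) ^ ↧ₙ r ≤ 2^ℤ (↥ r) ^ ↧ₙ p
2^-mono p@record{} r@record{} (*≤* p≤r) =
  subst₂ _≤_ (sym (2^ℤ-^ (↥ p) (↧ₙ r))) (sym (2^ℤ-^ (↥ r) (↧ₙ p))) (2^ℤ-mono p≤r)

↧≢0 : ∀ p → ℕ.NonZero (↧ₙ p)
↧≢0 record{} = _

≤2^-≥2^⇒≤ : ∀ {y z p r} → 0ℚ ≤ y → 0ℚ ≤ z → p ≤ r → y ≤2^ p → z ≥2^ r → y ≤ z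
≤2^-≥2^⇒≤ {y} {z} {p} {r} 0≤y 0≤z p≤r y≤ z≥ =
  ^-cancel (↧ₙ p) {{↧≢0 p}} 0≤z (^-cancel (↧ₙ r) {{↧≢0 r}} (^-nonNeg (↧ₙ p) 0≤z) (begin
  (y ^ ↧ₙ p) ^ ↧ₙ r        ≤⟨ ^-mono (↧ₙ r) (^-nonNeg (↧ₙ p) 0≤y) y≤ ⟩
  2^ℤ (↥ p) ^ ↧ₙ r         ≤⟨ 2^-mono p r p≤r ⟩
  2^ℤ (↥ r) ^ ↧ₙ p         ≤⟨ ^-mono (↧ₙ p) (<⇒≤ (2^ℤ-pos (↥ r))) z≥ ⟩
  (z ^ ↧ₙ r) ^ ↧ₙ p        ≡⟨ ^-^-comm z (↧ₙ r) (↧ₙ p) ⟩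
  (z ^ ↧ₙ p) ^ ↧ₙ r        ∎))
  where open ≤-Reasoning

≤2^-weaken : ∀ {y p r} → 0ℚ ≤ y → p ≤ r → y ≤2^ p → y ≤2^ r
≤2^-weaken {y} {p} {r} 0≤y p≤r y≤ = ^-cancel (↧ₙ p) {{↧≢0 p}} (<⇒≤ (2^ℤ-pos (↥ r))) (begin
  (y ^ ↧ₙ r) ^ ↧ₙ p        ≡⟨ ^-^-comm y (↧ₙ r) (↧ₙ p) ⟩
  (y ^ ↧ₙ p) ^ ↧ₙ r        ≤⟨ ^-mono (↧ₙ r) (^-nonNeg (↧ₙ p) 0≤y) y≤ ⟩
  2^ℤ (↥ p) ^ ↧ₙ r         ≤⟨ 2^-mono p r p≤r ⟩
  2^ℤ (↥ r) ^ ↧ₙ p         ∎)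
  where open ≤-Reasoning

bernoulli : ∀ {q d} n → 0ℚ ≤ q → 0ℚ ≤ d → q ^ n * (q + fromℕ n * d) ≤ q * (q + d) ^ n
bernoulli {q} {d} zero 0≤q 0≤d = ≤-reflexive
  (solve 2 (λ q d → con 1ℚ :* (q :+ con 0ℚ :* d) := q :* con 1ℚ) refl q d)
bernoulli {q} {d} (suc n) 0≤q 0≤d = begin
  q * q ^ n * (q + fromℕ (suc n) * d)
    ≡⟨ cong (λ k → q * q ^ n * (q + k * d)) (fromℕ-suc n) ⟩
  q * q ^ n * (q + (1ℚ + m) * d)
    ≡⟨ +-identityʳ _ ⟨
  q * q ^ n * (q + (1ℚ + m) * d) + 0ℚ
    ≤⟨ +-monoʳ-≤ (q * q ^ n * (q + (1ℚ + m) * d))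
         (*-nonNeg 0≤d (*-nonNeg (^-nonNeg n 0≤q) (*-nonNeg (fromℕ-≥0 n) 0≤d))) ⟩
  q * q ^ n * (q + (1ℚ + m) * d) + d * (q ^ n * (m * d))
    ≡⟨ solve 4 (λ q d a m → q :* a :* (q :+ (con 1ℚ :+ m) :* d) :+ d :* (a :* (m :* d))
         := (q :+ d) :* (a :* (q :+ m :* d))) refl q d (q ^ n) m ⟩
  (q + d) * (q ^ n * (q + m * d))
    ≤⟨ *-monoʳ (+-mono-≤ 0≤q 0≤d) (bernoulli n 0≤q 0≤d) ⟩
  (q + d) * (q * (q + d) ^ n)
    ≡⟨ solve 3 (λ q d a → (q :+ d) :* (q :* a) := q :* ((q :+ d) :* a)) refl q d ((q + d) ^ n) ⟩
  q * (q + d) ^ suc n ∎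
  where
  open ≤-Reasoning
  m = fromℕ n

powers-separate : ∀ {q s} → 0ℚ < q → q < s → ∃ λ k → 2ℚ * q ^ suc k ≤ s ^ suc k
powers-separate {q} {s} 0<q q<s = k , *-cancelʳ q 0<q (begin
  2ℚ * q ^ K * q             ≡⟨ solve 2 (λ a q → con 2ℚ :* a :* q := a :* (q :+ q)) refl (q ^ K) q ⟩
  q ^ K * (q + q)            ≤⟨ *-monoʳ (^-nonNeg K (<⇒≤ 0<q)) (+-monoʳ-≤ q q≤Kd) ⟩
  q ^ K * (q + fromℕ K * d)  ≤⟨ bernoulli K (<⇒≤ 0<q) (<⇒≤ 0<d) ⟩
  q * (q + d) ^ K            ≡⟨ cong (λ t → q * t ^ K) (solve 2 (λ q s → q :+ (s :+ :- q) := s) refl q s) ⟩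
  q * s ^ K                  ≡⟨ *-comm q (s ^ K) ⟩
  s ^ K * q                  ∎)
  where
  open ≤-Reasoning
  d = s - q
  0<d = <⇒0<- q<s
  arch = archimedean q 0<d
  k = proj₁ arch
  K = suc k
  q≤Kd : q ≤ fromℕ K * d
  q≤Kd = begin
    q                    ≤⟨ proj₂ arch ⟩
    fromℕ k * d          ≡⟨ +-identityˡ _ ⟨
    0ℚ + fromℕ k * d     ≤⟨ +-monoˡ-≤ (fromℕ k * d) (<⇒≤ 0<d) ⟩
    d + fromℕ k * d      ≡⟨ solve 2 (λ d m → d :+ m :* d := (con 1ℚ :+ m) :* d) refl d (fromℕ k) ⟩
    (1ℚ + fromℕ k) * d   ≡⟨ cong (_* d) (fromℕ-suc k) ⟨
    fromℕ K * d          ∎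

1/suc : ℕ → ℚ
1/suc k = mkℚ (+ 1) k (1-coprimeTo (suc k))

≤2^-separate : ∀ {q s p r} k → 0ℚ < q → 0ℚ ≤ s → 2ℚ * q ^ suc k ≤ s ^ suc k →
               r ≤ p + 1/suc k → q ≥2^ p → s ≥2^ r
≤2^-separate {q} {s} {p@record{}} {r@record{}} k 0<q 0≤s sep r≤ q≥ =
  ^-cancel (n ℕ.* K) (^-nonNeg n′ 0≤s) (begin
  2^ℤ (↥ r) ^ (n ℕ.* K)               ≡⟨ 2^ℤ-^ (↥ r) (n ℕ.* K) ⟩
  2^ℤ (↥ r ℤ.* + (n ℕ.* K))           ≤⟨ 2^ℤ-mono exponents ⟩
  2^ℤ ((↥ p ℤ.* + K ℤ.+ + 1 ℤ.* + n) ℤ.* + n′)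
                                      ≡⟨ 2^ℤ-^ (↥ p ℤ.* + K ℤ.+ + 1 ℤ.* + n) n′ ⟨
  2^ℤ (↥ p ℤ.* + K ℤ.+ + 1 ℤ.* + n) ^ n′
                                      ≡⟨ cong (_^ n′) (2^ℤ-homo-+ (↥ p ℤ.* + K) (+ 1 ℤ.* + n)) ⟩
  (2^ℤ (↥ p ℤ.* + K) * 2^ℤ (+ 1 ℤ.* + n)) ^ n′
                                      ≡⟨ cong₂ (λ a b → (a * b) ^ n′) (sym (2^ℤ-^ (↥ p) K)) (cong 2^ℤ_ (ℤ.*-identityˡ (+ n))) ⟩
  (2^ℤ (↥ p) ^ K * 2ℚ ^ n) ^ n′       ≤⟨ ^-mono n′ (*-nonNeg (^-nonNeg K (<⇒≤ (2^ℤ-pos (↥ p)))) 0≤2ⁿ)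
                                           (*-monoˡ 0≤2ⁿ (^-mono K (<⇒≤ (2^ℤ-pos (↥ p))) q≥)) ⟩
  ((q ^ n) ^ K * 2ℚ ^ n) ^ n′         ≡⟨ cong (_^ n′) (trans (cong (_* 2ℚ ^ n) (^-^-comm q n K)) (trans (*-comm ((q ^ K) ^ n) (2ℚ ^ n)) (sym (^-distrib-* 2ℚ (q ^ K) n)))) ⟩
  ((2ℚ * q ^ K) ^ n) ^ n′             ≤⟨ ^-mono n′ (^-nonNeg n 0≤2qᴷ) (^-mono n 0≤2qᴷ sep) ⟩
  ((s ^ K) ^ n) ^ n′                  ≡⟨ cong (_^ n′) (trans (^-assocʳ s K n) (cong (s ^_) (ℕ.*-comm K n))) ⟩
  (s ^ (n ℕ.* K)) ^ n′                ≡⟨ ^-^-comm s (n ℕ.* K) n′ ⟩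
  (s ^ n′) ^ (n ℕ.* K)                ∎)
  where
  open ≤-Reasoning
  K = suc k
  n = ↧ₙ p
  n′ = ↧ₙ r
  0≤2ⁿ = <⇒≤ (2^ℤ-pos (+ n))
  0≤2qᴷ = *-nonNeg (from-yes (0ℚ ≤? 2ℚ)) (^-nonNeg K (<⇒≤ 0<q))
  exponents : ↥ r ℤ.* + (n ℕ.* K) ℤ.≤ (↥ p ℤ.* + K ℤ.+ + 1 ℤ.* + n) ℤ.* + n′
  exponents = ℚᵘ.drop-*≤* (ℚᵘ.≤-trans (toℚᵘ-mono-≤ r≤)
    (ℚᵘ.≤-reflexive (toℚᵘ-homo-+ p (1/suc k))))

-- If 1 + p/2ᵏ > 0 then (1 + p/2ᵏ)^(2ᵏ) is a lower bound of eᵖ, increasing in k, and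
-- eᵖ is the supremum of these bounds; y ≥exp p reads y ≥ eᵖ as 1 ≤ y e⁻ᵖ.
1+_/2^_ : ℚ → ℕ → ℚ
1+ p /2^ k = 1ℚ + ½ ^ k * p

infix 4 _≤exp_ _≥exp_

_≤exp_ _≥exp_ : ℚ → ℚ → Set
y ≤exp p = ∃ λ k → 0ℚ < 1+ p /2^ k × y ≤ (1+ p /2^ k) ^ (2 ℕ.^ k)
y ≥exp p = ∃ λ k → 0ℚ < 1+ - p /2^ k × 1ℚ ≤ y * (1+ - p /2^ k) ^ (2 ℕ.^ k)

0≤p*p : ∀ p → 0ℚ ≤ p * p
0≤p*p p with ≤-total 0ℚ p
... | inj₁ 0≤p = *-nonNeg 0≤p 0≤p
... | inj₂ p≤0 = subst (0ℚ ≤_) (solve 1 (λ p → :- p :* :- p := p :* p) refl p)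
  (*-nonNeg (neg-antimono-≤ p≤0) (neg-antimono-≤ p≤0))

½^-pos : ∀ k → 0ℚ < ½ ^ k
½^-pos k = ^-pos k (from-yes (0ℚ <? ½))

1+/2^-square : ∀ p k → 0ℚ < 1+ p /2^ k →
               0ℚ < 1+ p /2^ suc k × 1+ p /2^ k ≤ (1+ p /2^ suc k) ^ 2
1+/2^-square p k 0<u = 0<w , u≤w²
  where
  open ≤-Reasoning
  u = 1+ p /2^ k
  w = 1+ p /2^ suc k
  v = ½ * ½ ^ k * p
  u≡ : u ≡ 1ℚ + (v + v)
  u≡ = cong (λ t → 1ℚ + t) (solve 2 (λ h p → h :* p := con ½ :* h :* p :+ con ½ :* h :* p) refl (½ ^ k) p)
  0<w : 0ℚ < w
  0<w = begin-strict
    0ℚ               <⟨ *-pos (from-yes (0ℚ <? ½)) (+-mono-< 0<1 0<u) ⟩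
    ½ * (1ℚ + u)     ≡⟨ cong (λ u → ½ * (1ℚ + u)) u≡ ⟩
    ½ * (1ℚ + (1ℚ + (v + v)))
                     ≡⟨ solve 1 (λ v → con ½ :* (con 1ℚ :+ (con 1ℚ :+ (v :+ v))) := con 1ℚ :+ v) refl v ⟩
    w                ∎
  u≤w² : u ≤ w ^ 2
  u≤w² = begin
    u                          ≡⟨ u≡ ⟩
    1ℚ + (v + v)               ≡⟨ +-identityʳ _ ⟨
    1ℚ + (v + v) + 0ℚ          ≤⟨ +-monoʳ-≤ (1ℚ + (v + v)) (0≤p*p v) ⟩
    1ℚ + (v + v) + v * v       ≡⟨ solve 1 (λ v → con 1ℚ :+ (v :+ v) :+ v :* v
                                    := (con 1ℚ :+ v) :* ((con 1ℚ :+ v) :* con 1ℚ)) refl v ⟩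
    w ^ 2                      ∎

1+/2^-lift : ∀ p k j → 0ℚ < 1+ p /2^ k →
             0ℚ < 1+ p /2^ (j ℕ.+ k) ×
             (1+ p /2^ k) ^ (2 ℕ.^ k) ≤ (1+ p /2^ (j ℕ.+ k)) ^ (2 ℕ.^ (j ℕ.+ k))
1+/2^-lift p k zero    0<u = 0<u , ≤-refl
1+/2^-lift p k (suc j) 0<u with 1+/2^-lift p k j 0<u
... | 0<w , u≤w = proj₁ sq , (begin
  (1+ p /2^ k) ^ (2 ℕ.^ k)                  ≤⟨ u≤w ⟩
  (1+ p /2^ l) ^ (2 ℕ.^ l)                  ≤⟨ ^-mono (2 ℕ.^ l) (<⇒≤ 0<w) (proj₂ sq) ⟩
  ((1+ p /2^ suc l) ^ 2) ^ (2 ℕ.^ l)        ≡⟨ ^-assocʳ (1+ p /2^ suc l) 2 (2 ℕ.^ l) ⟩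
  (1+ p /2^ suc l) ^ (2 ℕ.^ suc l)          ∎)
  where
  open ≤-Reasoning
  l = j ℕ.+ k
  sq = 1+/2^-square p l 0<w

^-<1 : ∀ {p} n .{{_ : ℕ.NonZero n}} → 0ℚ ≤ p → p < 1ℚ → p ^ n < 1ℚ
^-<1 {p} n 0≤p p<1 = subst (p ^ n <_) (1^ n) (^-mono-< n 0≤p p<1)

≥exp⇒≤exp⇒≤ : ∀ {y p r} → y ≥exp p → y ≤exp r → p ≤ r
≥exp⇒≤exp⇒≤ {y} {p} {r} (k , 0<b₀ , y≥) (l , 0<a₀ , y≤) with p ≤? r
... | yes p≤r = p≤r
... | no  p≰r = contradiction (≤-<-trans 1≤abⁿ (^-<1 n {{ℕ.m^n≢0 2 m}} (<⇒≤ (*-pos 0<a 0<b)) ab<1)) (<-irrefl refl)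
  where
  open ≤-Reasoning
  m = l ℕ.+ k
  n = 2 ℕ.^ m
  h = ½ ^ m
  a = 1+ r /2^ m
  b = 1+ - p /2^ m
  liftᵇ = 1+/2^-lift (- p) k l 0<b₀
  liftᵃ : 0ℚ < 1+ r /2^ m × (1+ r /2^ l) ^ (2 ℕ.^ l) ≤ (1+ r /2^ m) ^ (2 ℕ.^ m)
  liftᵃ = subst (λ i → 0ℚ < 1+ r /2^ i × (1+ r /2^ l) ^ (2 ℕ.^ l) ≤ (1+ r /2^ i) ^ (2 ℕ.^ i))
            (ℕ.+-comm k l) (1+/2^-lift r l k 0<a₀)
  0<a = proj₁ liftᵃ
  0<b = proj₁ liftᵇ
  0≤b₀ⁿ = ^-nonNeg (2 ℕ.^ k) (<⇒≤ 0<b₀)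
  1≤abⁿ : 1ℚ ≤ (a * b) ^ n
  1≤abⁿ = begin
    1ℚ                                          ≤⟨ y≥ ⟩
    y * (1+ - p /2^ k) ^ (2 ℕ.^ k)              ≤⟨ *-monoˡ 0≤b₀ⁿ (≤-trans y≤ (proj₂ liftᵃ)) ⟩
    a ^ n * (1+ - p /2^ k) ^ (2 ℕ.^ k)          ≤⟨ *-monoʳ (^-nonNeg n (<⇒≤ 0<a)) (proj₂ liftᵇ) ⟩
    a ^ n * b ^ n                               ≡⟨ ^-distrib-* a b n ⟨
    (a * b) ^ n                                 ∎
  ab<1 : a * b < 1ℚ
  ab<1 = begin-strict
    a * b                        <⟨ *-monoˡ-<-pos b {{positive 0<b}} (+-monoʳ-< 1ℚ
                                      (*-monoʳ-<-pos h {{positive (½^-pos m)}} (≰⇒> p≰r))) ⟩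
    (1ℚ + h * p) * b             ≡⟨ +-identityʳ _ ⟨
    (1ℚ + h * p) * b + 0ℚ        ≤⟨ +-monoʳ-≤ ((1ℚ + h * p) * b) (0≤p*p (h * p)) ⟩
    (1ℚ + h * p) * b + h * p * (h * p)
      ≡⟨ solve 2 (λ h p → (con 1ℚ :+ h :* p) :* (con 1ℚ :+ h :* (:- p)) :+ h :* p :* (h :* p) := con 1ℚ) refl h p ⟩
    1ℚ                           ∎

½^k*k<1 : ∀ k → ½ ^ k * fromℕ k < 1ℚ
½^k*k<1 zero    = from-yes (½ ^ 0 * fromℕ 0 <? 1ℚ)
½^k*k<1 (suc k) = begin-strict
  ½ ^ suc k * fromℕ (suc k)            ≡⟨ cong (½ ^ suc k *_) (fromℕ-suc k) ⟩
  ½ * ½ ^ k * (1ℚ + fromℕ k)           ≡⟨ solve 2 (λ h k → con ½ :* h :* (con 1ℚ :+ k) := con ½ :* h :+ con ½ :* (h :* k)) refl (½ ^ k) (fromℕ k) ⟩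
  ½ * ½ ^ k + ½ * (½ ^ k * fromℕ k)    <⟨ +-mono-≤-< (*-monoʳ (<⇒≤ 0<½) ½ᵏ≤1) (*-monoʳ-<-pos ½ (½^k*k<1 k)) ⟩
  1ℚ                                   ∎
  where
  open ≤-Reasoning
  0<½ = ½^-pos 1
  ½ᵏ≤1 : ½ ^ k ≤ 1ℚ
  ½ᵏ≤1 = subst (½ ^ k ≤_) (1^ k) (^-mono k (<⇒≤ (from-yes (0ℚ <? ½))) (from-yes (½ ≤? 1ℚ)))

fromℕ-mono : ∀ {m n} → m ℕ.≤ n → fromℕ m ≤ fromℕ n
fromℕ-mono m≤n = *≤* (ℤ.*-monoʳ-≤-nonNeg (+ 1) (ℤ.+≤+ m≤n))

p≤d*k⇒½ᵏp≤d : ∀ {p d} k → 0ℚ < d → p ≤ fromℕ k * d → ½ ^ k * p < d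
p≤d*k⇒½ᵏp≤d {p} {d} k 0<d p≤ = begin-strict
  ½ ^ k * p              ≤⟨ *-monoʳ (<⇒≤ (½^-pos k)) p≤ ⟩
  ½ ^ k * (fromℕ k * d)  ≡⟨ *-assoc (½ ^ k) (fromℕ k) d ⟨
  ½ ^ k * fromℕ k * d    <⟨ *-monoˡ-<-pos d {{positive 0<d}} (½^k*k<1 k) ⟩
  1ℚ * d                 ≡⟨ *-identityˡ d ⟩
  d                      ∎
  where open ≤-Reasoning

module ExpSeparate {p r} (p<r : p < r) where
  open ≤-Reasoning
  k₁ = archimedean p 0<1
  k₂ = archimedean (- r) 0<1
  k₃ = archimedean (p * r) (<⇒0<- p<r)
  k = proj₁ k₁ ℕ.+ (proj₁ k₂ ℕ.+ proj₁ k₃)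
  n = 2 ℕ.^ k
  h = ½ ^ k
  a = 1+ r /2^ k
  b = 1+ - p /2^ k
  small : ∀ {t d} (m : ∃ λ m → t ≤ fromℕ m * d) → 0ℚ < d → proj₁ m ℕ.≤ k → h * t < d
  small (m , t≤) 0<d m≤k = p≤d*k⇒½ᵏp≤d k 0<d (≤-trans t≤ (*-monoˡ (<⇒≤ 0<d) (fromℕ-mono m≤k)))
  0<b : 0ℚ < b
  0<b = subst (0ℚ <_) (solve 2 (λ h p → con 1ℚ :+ :- (h :* p) := con 1ℚ :+ h :* (:- p)) refl h p)
    (<⇒0<- (small k₁ 0<1 (ℕ.m≤m+n (proj₁ k₁) _)))
  0<a : 0ℚ < a
  0<a = subst (0ℚ <_) (solve 2 (λ h r → con 1ℚ :+ :- (h :* (:- r)) := con 1ℚ :+ h :* r) refl h r)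
    (<⇒0<- (small k₂ 0<1 (ℕ.≤-trans (ℕ.m≤m+n (proj₁ k₂) _) (ℕ.m≤n+m _ (proj₁ k₁)))))
  1≤ab : 1ℚ ≤ a * b
  1≤ab = begin
    1ℚ                                    ≡⟨ +-identityʳ 1ℚ ⟨
    1ℚ + 0ℚ                               ≤⟨ +-monoʳ-≤ 1ℚ (<⇒≤ (*-pos (½^-pos k) (<⇒0<-
      (small k₃ (<⇒0<- p<r) (ℕ.≤-trans (ℕ.m≤n+m _ (proj₁ k₂)) (ℕ.m≤n+m _ (proj₁ k₁))))))) ⟩
    1ℚ + h * (r - p - h * (p * r))
      ≡⟨ solve 3 (λ h p r → con 1ℚ :+ h :* (r :+ :- p :+ :- (h :* (p :* r)))
           := (con 1ℚ :+ h :* r) :* (con 1ℚ :+ h :* (:- p))) refl h p r ⟩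
    a * b                                 ∎

exp-separate : ∀ {y p r} → p < r → y ≥exp p ⊎ y ≤exp r
exp-separate {y} {p} {r} p<r = separate (1ℚ ≤? y * b ^ n)
  where
  open ≤-Reasoning
  open ExpSeparate p<r
  separate : Dec (1ℚ ≤ y * b ^ n) → y ≥exp p ⊎ y ≤exp r
  separate (yes 1≤) = inj₁ (k , 0<b , 1≤)
  separate (no  1≰) = inj₂ (k , 0<a , *-cancelʳ (b ^ n) (^-pos n 0<b) (begin
    y * b ^ n      ≤⟨ <⇒≤ (≰⇒> 1≰) ⟩
    1ℚ             ≤⟨ 1≤^ n 1≤ab ⟩
    (a * b) ^ n    ≡⟨ ^-distrib-* a b n ⟩
    a ^ n * b ^ n  ∎))

-- Dedekind reals with untruncated cuts: location and inhabitedness compute rational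
-- approximations.
record ℝ : Set₁ where
  field
    lower upper : ℚ → Set
    inhabitedᴸ  : ∃ lower
    inhabitedᵁ  : ∃ upper
    closedᴸ     : ∀ {q r} → q < r → lower r → lower q
    closedᵁ     : ∀ {q r} → q < r → upper q → upper r
    openᴸ       : ∀ {q} → lower q → ∃ λ r → q < r × lower r
    openᵁ       : ∀ {r} → upper r → ∃ λ q → q < r × upper q
    ordered     : ∀ {q r} → lower q → upper r → q < r
    located     : ∀ {q r} → q < r → lower q ⊎ upper r

open ℝ

-- The real determined by its rational lower bounds A and upper bounds B.
fromBounds : (A B : ℚ → Set) → ∃ A → ∃ B →
             (∀ {p r} → A p → B r → p ≤ r) →
             (∀ {p r} → p < r → A p ⊎ B r) → ℝ
fromBounds A B (a , Aa) (b , Bb) ordered′ located′ = record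
  { lower      = λ q → ∃ λ p → q < p × A p
  ; upper      = λ r → ∃ λ p → p < r × B p
  ; inhabitedᴸ = a - 1ℚ , a , p-1<p a , Aa
  ; inhabitedᵁ = b + 1ℚ , b , p<p+1 b , Bb
  ; closedᴸ    = λ { q<r (p , r<p , Ap) → p , <-trans q<r r<p , Ap }
  ; closedᵁ    = λ { q<r (p , p<q , Bp) → p , <-trans p<q q<r , Bp }
  ; openᴸ      = λ { (p , q<p , Ap) → let (m , q<m , m<p) = <-dense q<p in m , q<m , p , m<p , Ap }
  ; openᵁ      = λ { (p , p<r , Bp) → let (m , p<m , m<r) = <-dense p<r in m , m<r , p , p<m , Bp }
  ; ordered    = λ { (p , q<p , Ap) (p′ , p′<r , Bp′) → <-trans (<-≤-trans q<p (ordered′ Ap Bp′)) p′<r }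
  ; located    = λ q<r →
      let (m , q<m , m<r) = <-dense q<r
          (l , q<l , l<m) = <-dense q<m
      in Sum.map (λ Al → l , q<l , Al) (λ Bm → m , m<r , Bm) (located′ l<m)
  }

infix 4 _≤ᴿ_

_≤ᴿ_ : ℝ → ℝ → Set
x ≤ᴿ y = ∀ q → lower x q → lower y q

ι : ℚ → ℝ
ι a = fromBounds (_≤ a) (a ≤_) (a , ≤-refl) (a , ≤-refl) ≤-trans located′
  where
  located′ : ∀ {p r} → p < r → p ≤ a ⊎ a ≤ r
  located′ {p} p<r with p ≤? a
  ... | yes p≤a = inj₁ p≤a
  ... | no  p≰a = inj₂ (<⇒≤ (<-trans (≰⇒> p≰a) p<r))

narrow : ∀ x {ε} → 0ℚ < ε → ∃₂ λ a b → lower x a × upper x b × b ≤ a + ε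
narrow x {ε} 0<ε = walk (proj₁ arch) a₀ (proj₂ (inhabitedᴸ x)) (begin
  b₀                             ≡⟨ solve 2 (λ a b → b := a :+ (b :+ :- a)) refl a₀ b₀ ⟩
  a₀ + (b₀ - a₀)                 ≤⟨ +-monoʳ-≤ a₀ (proj₂ arch) ⟩
  a₀ + fromℕ (proj₁ arch) * h    ∎)
  where
  open ≤-Reasoning
  a₀ = proj₁ (inhabitedᴸ x)
  b₀ = proj₁ (inhabitedᵁ x)
  h = ½ * ε
  0<h = *-pos (½^-pos 1) 0<ε
  arch = archimedean (b₀ - a₀) 0<h
  h<ε : h < ε
  h<ε = subst (h <_) (*-identityˡ ε) (*-monoˡ-<-pos ε {{positive 0<ε}} (from-yes (½ <? 1ℚ)))
  walk : ∀ n a → lower x a → b₀ ≤ a + fromℕ n * h → ∃₂ λ a b → lower x a × upper x b × b ≤ a + ε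
  walk zero    a La b₀≤ = contradiction
    (<-≤-trans (ordered x La (proj₂ (inhabitedᵁ x)))
      (subst (b₀ ≤_) (trans (cong (λ t → a + t) (*-zeroˡ h)) (+-identityʳ a)) b₀≤))
    (<-irrefl refl)
  walk (suc n) a La b₀≤ with located x (+-monoʳ-< a h<ε)
  ... | inj₂ Uaε = a , a + ε , La , Uaε , ≤-refl
  ... | inj₁ Lah = walk n (a + h) Lah (begin
    b₀                          ≤⟨ b₀≤ ⟩
    a + fromℕ (suc n) * h       ≡⟨ cong (λ k → a + k * h) (fromℕ-suc n) ⟩
    a + (1ℚ + fromℕ n) * h      ≡⟨ solve 3 (λ a k h → a :+ (con 1ℚ :+ k) :* h := a :+ h :+ k :* h) refl a (fromℕ n) h ⟩
    a + h + fromℕ n * h         ∎)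

infixl 6 _+ᴿ_ _-ᴿ_
infixl 7 _⊓ᴿ_ _÷ᴿ_
infix  8 -ᴿ_

+-halves : ∀ a b d → (a + ½ * d) + (b + ½ * d) ≡ (a + b) + d
+-halves = solve 3 (λ a b d → (a :+ con ½ :* d) :+ (b :+ con ½ :* d) := (a :+ b) :+ d) refl

_+ᴿ_ : ℝ → ℝ → ℝ
x +ᴿ y = fromBounds
  (λ q → ∃₂ λ a b → lower x a × lower y b × q ≤ a + b)
  (λ r → ∃₂ λ a b → upper x a × upper y b × a + b ≤ r)
  (let (a , La) = inhabitedᴸ x; (b , Lb) = inhabitedᴸ y in a + b , a , b , La , Lb , ≤-refl)
  (let (a , Ua) = inhabitedᵁ x; (b , Ub) = inhabitedᵁ y in a + b , a , b , Ua , Ub , ≤-refl)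
  (λ { (a , b , La , Lb , p≤) (a′ , b′ , Ua′ , Ub′ , ≤r) →
       ≤-trans p≤ (≤-trans (+-mono-≤ (<⇒≤ (ordered x La Ua′)) (<⇒≤ (ordered y Lb Ub′))) ≤r) })
  located′
  where
  open ≤-Reasoning
  module _ {p r} (p<r : p < r) where
    ε = ½ * (r - p)
    separate : ∀ {a a′ b b′} → lower x a → upper x a′ → a′ ≤ a + ε →
               lower y b → upper y b′ → b′ ≤ b + ε → Dec (p ≤ a + b) →
               (∃₂ λ a b → lower x a × lower y b × p ≤ a + b) ⊎
               (∃₂ λ a b → upper x a × upper y b × a + b ≤ r)
    separate {a} {a′} {b} {b′} La Ua′ a′≤ Lb Ub′ b′≤ (yes p≤) = inj₁ (a , b , La , Lb , p≤)
    separate {a} {a′} {b} {b′} La Ua′ a′≤ Lb Ub′ b′≤ (no  p≰) = inj₂ (a′ , b′ , Ua′ , Ub′ , (begin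
      a′ + b′                ≤⟨ +-mono-≤ a′≤ b′≤ ⟩
      (a + ε) + (b + ε)      ≡⟨ +-halves a b (r - p) ⟩
      (a + b) + (r - p)      ≤⟨ +-monoˡ-≤ (r - p) (<⇒≤ (≰⇒> p≰)) ⟩
      p + (r - p)            ≡⟨ solve 2 (λ p r → p :+ (r :+ :- p) := r) refl p r ⟩
      r                      ∎))
    located′ : (∃₂ λ a b → lower x a × lower y b × p ≤ a + b) ⊎
               (∃₂ λ a b → upper x a × upper y b × a + b ≤ r)
    located′ =
      let 0<ε = *-pos (½^-pos 1) (<⇒0<- p<r)
          (a , a′ , La , Ua′ , a′≤) = narrow x 0<ε
          (b , b′ , Lb , Ub′ , b′≤) = narrow y 0<ε
      in separate La Ua′ a′≤ Lb Ub′ b′≤ (p ≤? a + b)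

neg-involutive : ∀ q → - (- q) ≡ q
neg-involutive = solve 1 (λ q → :- (:- q) := q) refl

-ᴿ_ : ℝ → ℝ
-ᴿ x = record
  { lower      = λ q → upper x (- q)
  ; upper      = λ r → lower x (- r)
  ; inhabitedᴸ = let (b , Ub) = inhabitedᵁ x in - b , subst (upper x) (sym (neg-involutive b)) Ub
  ; inhabitedᵁ = let (a , La) = inhabitedᴸ x in - a , subst (lower x) (sym (neg-involutive a)) La
  ; closedᴸ    = λ q<r → closedᵁ x (neg-antimono-< q<r)
  ; closedᵁ    = λ q<r → closedᴸ x (neg-antimono-< q<r)
  ; openᴸ      = λ U → let (p , p<-q , Up) = openᵁ x U in
                   - p , subst (_< - p) (neg-involutive _) (neg-antimono-< p<-q)
                       , subst (upper x) (sym (neg-involutive p)) Up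
  ; openᵁ      = λ L → let (p , -r<p , Lp) = openᴸ x L in
                   - p , subst (- p <_) (neg-involutive _) (neg-antimono-< -r<p)
                       , subst (lower x) (sym (neg-involutive p)) Lp
  ; ordered    = λ U L → subst₂ _<_ (neg-involutive _) (neg-involutive _) (neg-antimono-< (ordered x L U))
  ; located    = λ q<r → Sum.swap (located x (neg-antimono-< q<r))
  }

_-ᴿ_ : ℝ → ℝ → ℝ
x -ᴿ y = x +ᴿ (-ᴿ y)

_⊓ᴿ_ : ℝ → ℝ → ℝ
x ⊓ᴿ y = record
  { lower      = λ q → lower x q × lower y q
  ; upper      = λ r → upper x r ⊎ upper y r
  ; inhabitedᴸ = inhabitedᴸ′
  ; inhabitedᵁ = let (b , Ub) = inhabitedᵁ x in b , inj₁ Ub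
  ; closedᴸ    = λ { q<r (Lx , Ly) → closedᴸ x q<r Lx , closedᴸ y q<r Ly }
  ; closedᵁ    = λ q<r → Sum.map (closedᵁ x q<r) (closedᵁ y q<r)
  ; openᴸ      = openᴸ′
  ; openᵁ      = λ { (inj₁ U) → let (p , p<r , Up) = openᵁ x U in p , p<r , inj₁ Up
                   ; (inj₂ U) → let (p , p<r , Up) = openᵁ y U in p , p<r , inj₂ Up }
  ; ordered    = λ { (Lx , Ly) (inj₁ U) → ordered x Lx U
                   ; (Lx , Ly) (inj₂ U) → ordered y Ly U }
  ; located    = located′
  }
  where
  inhabitedᴸ′ : ∃ λ q → lower x q × lower y q
  inhabitedᴸ′ with inhabitedᴸ x | inhabitedᴸ y
  ... | a , La | b , Lb with <-cmp a b
  ... | tri< a<b _ _  = a , La , closedᴸ y a<b Lb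
  ... | tri≈ _ refl _ = a , La , Lb
  ... | tri> _ _ b<a  = b , closedᴸ x b<a La , Lb
  openᴸ′ : ∀ {q} → lower x q × lower y q → ∃ λ r → q < r × lower x r × lower y r
  openᴸ′ (Lx , Ly) with openᴸ x Lx | openᴸ y Ly
  ... | a , q<a , La | b , q<b , Lb with <-cmp a b
  ... | tri< a<b _ _  = a , q<a , La , closedᴸ y a<b Lb
  ... | tri≈ _ refl _ = a , q<a , La , Lb
  ... | tri> _ _ b<a  = b , q<b , closedᴸ x b<a La , Lb
  located′ : ∀ {q r} → q < r → (lower x q × lower y q) ⊎ (upper x r ⊎ upper y r)
  located′ q<r with located x q<r | located y q<r
  ... | inj₁ Lx | inj₁ Ly = inj₁ (Lx , Ly)
  ... | inj₂ Ux | _       = inj₂ (inj₁ Ux)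
  ... | inj₁ _  | inj₂ Uy = inj₂ (inj₂ Uy)

_÷ᴿ_ : ℝ → (n : ℕ) .{{_ : ℕ.NonZero n}} → ℝ
x ÷ᴿ n@(suc _) = record
  { lower      = λ q → lower x (q * m)
  ; upper      = λ r → upper x (r * m)
  ; inhabitedᴸ = let (a , La) = inhabitedᴸ x in a * 1/ m , subst (lower x) (sym (cancel a)) La
  ; inhabitedᵁ = let (b , Ub) = inhabitedᵁ x in b * 1/ m , subst (upper x) (sym (cancel b)) Ub
  ; closedᴸ    = λ q<r → closedᴸ x (mono q<r)
  ; closedᵁ    = λ q<r → closedᵁ x (mono q<r)
  ; openᴸ      = λ L → let (p , qm<p , Lp) = openᴸ x L in
                   p * 1/ m , reflect (subst (_ <_) (sym (cancel p)) qm<p) , subst (lower x) (sym (cancel p)) Lp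
  ; openᵁ      = λ U → let (p , p<rm , Up) = openᵁ x U in
                   p * 1/ m , reflect (subst (_< _) (sym (cancel p)) p<rm) , subst (upper x) (sym (cancel p)) Up
  ; ordered    = λ L U → reflect (ordered x L U)
  ; located    = λ q<r → located x (mono q<r)
  }
  where
  m = fromℕ n
  mono : ∀ {q r} → q < r → q * m < r * m
  mono = *-monoˡ-<-pos m
  reflect : ∀ {q r} → q * m < r * m → q < r
  reflect = *-cancelʳ-<-nonNeg m
  cancel : ∀ a → a * 1/ m * m ≡ a
  cancel a = trans (*-assoc a (1/ m) m) (trans (cong (a *_) (*-inverseˡ m)) (*-identityʳ a))

1≤fromℕ : ∀ n .{{_ : ℕ.NonZero n}} → 1ℚ ≤ fromℕ n
1≤fromℕ (suc n) = fromℕ-mono (ℕ.s≤s ℕ.z≤n)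

fromℕ≤2^ : ∀ n → fromℕ n ≤ 2ℚ ^ n
fromℕ≤2^ zero    = <⇒≤ 0<1
fromℕ≤2^ (suc n) = begin
  fromℕ (suc n)         ≡⟨ fromℕ-suc n ⟩
  1ℚ + fromℕ n          ≤⟨ +-mono-≤ (1≤2^ n) (fromℕ≤2^ n) ⟩
  2ℚ ^ n + 2ℚ ^ n       ≡⟨ solve 1 (λ a → a :+ a := con 2ℚ :* a) refl (2ℚ ^ n) ⟩
  2ℚ ^ suc n            ∎
  where open ≤-Reasoning

-- The rational p is a lower bound of log₂ n iff 2ᵖ ≤ n.
log₂ : (n : ℕ) .{{_ : ℕ.NonZero n}} → ℝ
log₂ n = fromBounds (fromℕ n ≥2^_) (fromℕ n ≤2^_)
  (0ℚ , subst (1ℚ ≤_) (sym (*-identityʳ (fromℕ n))) (1≤fromℕ n))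
  (fromℕ n , subst (_≤ 2ℚ ^ n) (sym (*-identityʳ (fromℕ n))) (fromℕ≤2^ n))
  (λ {p} {r} → ≥2^⇒≤2^⇒≤ {fromℕ n} {p} {r} (fromℕ-≥0 n))
  located′
  where
  located′ : ∀ {p r} → p < r → fromℕ n ≥2^ p ⊎ fromℕ n ≤2^ r
  located′ {p} {r} p<r with 2^ℤ (↥ p) ≤? fromℕ n ^ ↧ₙ p
  ... | yes n≥ = inj₁ n≥
  ... | no  n≱ = inj₂ (≤2^-weaken {fromℕ n} {p} {r} (fromℕ-≥0 n) (<⇒≤ p<r) (<⇒≤ (≰⇒> n≱)))

-- The natural logarithm, cut out of the rationals p by comparing n with eᵖ. The
-- bounds used miss at most the value itself, which does not change the cut.
log : (n : ℕ) .{{_ : ℕ.NonZero n}} → ℝ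
log n = fromBounds (fromℕ n ≥exp_) (fromℕ n ≤exp_)
  (0ℚ , 0 , 0<1 , subst (1ℚ ≤_) (sym (*-identityʳ (fromℕ n))) (1≤fromℕ n))
  (fromℕ n , 0 , <-≤-trans 0<1 (p≤p+q 1ℚ 0≤n) , subst (fromℕ n ≤_) (sym (*-identityʳ _))
    (subst (_≤ 1ℚ + 1ℚ * fromℕ n) (trans (+-identityˡ _) (*-identityˡ (fromℕ n))) (+-monoˡ-≤ (1ℚ * fromℕ n) (<⇒≤ 0<1))))
  ≥exp⇒≤exp⇒≤
  exp-separate
  where
  0≤n : 0ℚ ≤ 1ℚ * fromℕ n
  0≤n = subst (0ℚ ≤_) (sym (*-identityˡ (fromℕ n))) (fromℕ-≥0 n)
  p≤p+q : ∀ p {q} → 0ℚ ≤ q → p ≤ p + q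
  p≤p+q p {q} 0≤q = subst (_≤ p + q) (+-identityʳ p) (+-monoʳ-≤ p 0≤q)

2^ℤ∣↥p∣≥2^p : ∀ p → 2^ℤ (+ ℤ.∣ ↥ p ∣) ≥2^ p
2^ℤ∣↥p∣≥2^p p@record{} = begin
  2^ℤ (↥ p)              ≤⟨ 2^ℤ-mono (i≤∣i∣ (↥ p)) ⟩
  s                      ≡⟨ *-identityʳ s ⟨
  s * 1ℚ                 ≤⟨ *-monoʳ (<⇒≤ (2^ℤ-pos (+ ℤ.∣ ↥ p ∣))) (1≤^ (ℚ.denominator-1 p) (1≤2^ ℤ.∣ ↥ p ∣)) ⟩
  s ^ ↧ₙ p               ∎
  where
  open ≤-Reasoning
  s = 2^ℤ (+ ℤ.∣ ↥ p ∣)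
  i≤∣i∣ : ∀ i → i ℤ.≤ + ℤ.∣ i ∣
  i≤∣i∣ (+ n)    = ℤ.≤-refl
  i≤∣i∣ -[1+ n ] = ℤ.-≤+

-- 2ˣ is the supremum of the 2ᵖ over rational p < x.
2^_ : ℝ → ℝ
2^ x = fromBounds A B
  (0ℚ , inj₁ ≤-refl)
  (let (p , Up) = inhabitedᵁ x in 2^ℤ (+ ℤ.∣ ↥ p ∣) , 2^ℤ-pos (+ ℤ.∣ ↥ p ∣) , p , Up , 2^ℤ∣↥p∣≥2^p p)
  (λ {y} → ordered′ (y ≤? 0ℚ))
  (λ {y} y<z → located′ y<z (y ≤? 0ℚ))
  where
  A B : ℚ → Set
  A y = y ≤ 0ℚ ⊎ ∃ λ p → lower x p × y ≤2^ p
  B z = 0ℚ < z × ∃ λ p → upper x p × z ≥2^ p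
  ordered′ : ∀ {y z} → Dec (y ≤ 0ℚ) → A y → B z → y ≤ z
  ordered′ _         (inj₁ y≤0) (0<z , _) = ≤-trans y≤0 (<⇒≤ 0<z)
  ordered′ (yes y≤0) (inj₂ _)   (0<z , _) = ≤-trans y≤0 (<⇒≤ 0<z)
  ordered′ {y} {z} (no y≰0) (inj₂ (p , Lp , y≤)) (0<z , r , Ur , z≥) =
    ≤2^-≥2^⇒≤ {y} {z} {p} {r} (<⇒≤ (≰⇒> y≰0)) (<⇒≤ 0<z) (<⇒≤ (ordered x Lp Ur)) y≤ z≥
  separate : ∀ {y z p r} k → 0ℚ < y → 0ℚ < z → 2ℚ * y ^ suc k ≤ z ^ suc k →
             lower x p → upper x r → r ≤ p + 1/suc k → Dec (y ≤2^ p) → A y ⊎ B z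
  separate {p = p} _ _ _ _ Lp _ _ (yes y≤) = inj₁ (inj₂ (p , Lp , y≤))
  separate {y} {z} {p} {r} k 0<y 0<z sep Lp Ur r≤ (no y≰) =
    inj₂ (0<z , r , Ur , ≤2^-separate {y} {z} {p} {r} k 0<y (<⇒≤ 0<z) sep r≤ (<⇒≤ (≰⇒> y≰)))
  located′ : ∀ {y z} → y < z → Dec (y ≤ 0ℚ) → A y ⊎ B z
  located′ y<z (yes y≤0) = inj₁ (inj₁ y≤0)
  located′ {y} {z} y<z (no y≰0) =
    let 0<y = ≰⇒> y≰0
        (k , sep) = powers-separate 0<y y<z
        (p , r , Lp , Ur , r≤) = narrow x (positive⁻¹ (1/suc k))
    in separate {y} {z} {p} {r} k 0<y (<-trans 0<y y<z) sep Lp Ur r≤ (y ^ ↧ₙ p ≤? 2^ℤ (↥ p))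

_→∞ : (ℕ → ℝ) → Set
f →∞ = ∀ (M : ℚ) → ∃ λ N₀ → ∀ N → N₀ ℕ.≤ N → ι M ≤ᴿ f N

_→0 : (ℕ → ℝ) → Set
f →0 = ∀ (δ : ℚ) → 0ℚ < δ → ∃ λ N₀ → ∀ N → N₀ ℕ.≤ N → ι (- δ) ≤ᴿ f N × f N ≤ᴿ ι δ

Word : ℕ → Set
Word N = Vec (Fin 2) N

value : ∀ {N} → Word N → ℕ
value S = Vec.sum (Vec.tabulate λ n → toℕ (Vec.lookup S n) ℕ.* 2 ℕ.^ toℕ n)

-- (q, f) is a rational representation of S of height k = max{q, |f|}.
Represents : ∀ {N} → Word N → ℕ → ℕ → ℤ → Set
Represents {N} S k q f =
  0 ℕ.< q × ¬ (2 ℕ.∣ q) × + (2 ℕ.^ N) ℤ.∣ + q ℤ.* + value S ℤ.- f × k ≡ q ℕ.⊔ ℤ.∣ f ∣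

represents? : ∀ {N} (S : Word N) k q f → Dec (Represents S k q f)
represents? {N} S k q f =
  (0 ℕ.<? q) ×-dec ¬? (2 ℕ.∣? q) ×-dec (2 ℕ.^ N ℕ.∣? ℤ.∣ + q ℤ.* + value S ℤ.- f ∣) ×-dec (k ℕ.≟ q ℕ.⊔ ℤ.∣ f ∣)

Height : ∀ {N} → Word N → ℕ → Set
Height S k = ∃₂ (Represents S k)

height? : ∀ {N} (S : Word N) → Decidable (Height S)
height? S k = map′ to from
  (ℕ.anyUpTo? (λ q → ℕ.anyUpTo? (λ j → represents? S k q (+ j) ⊎-dec represents? S k q (ℤ.- (+ j))) (suc k)) (suc k))
  where
  Bounded : Set
  Bounded = ∃ λ q → q ℕ.< suc k × ∃ λ j → j ℕ.< suc k × (Represents S k q (+ j) ⊎ Represents S k q (ℤ.- (+ j)))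
  to : Bounded → Height S k
  to (q , _ , j , _ , inj₁ c) = q , + j , c
  to (q , _ , j , _ , inj₂ c) = q , ℤ.- (+ j) , c
  from : Height S k → Bounded
  from (q , f , c@(_ , _ , _ , refl)) =
    q , ℕ.s≤s (ℕ.m≤m⊔n q ℤ.∣ f ∣) , ℤ.∣ f ∣ , ℕ.s≤s (ℕ.m≤n⊔m q ℤ.∣ f ∣) ,
    Sum.map (λ eq → subst (Represents S k q) (sym eq) c)
            (λ eq → subst (Represents S k q) (sym (trans (cong ℤ.-_ eq) (ℤ.neg-involutive f))) c)
            (ℤ.+∣i∣≡i⊎+∣i∣≡-i f)

IsMinimum : (ℕ → Set) → ℕ → Set
IsMinimum P m = P m × (∀ {k} → P k → m ℕ.≤ k)

minimum : ∀ {P : ℕ → Set} → Decidable P → ∃ P → ∃ (IsMinimum P)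
minimum {P} P? (k , Pk) with search k
  where
  search : ∀ b → (∀ {j} → P j → b ℕ.≤ j) ⊎ ∃ (IsMinimum P)
  search zero    = inj₁ λ _ → ℕ.z≤n
  search (suc b) with search b
  ... | inj₂ found = inj₂ found
  ... | inj₁ b≤ with P? b
  ...   | yes Pb = inj₂ (b , Pb , b≤)
  ...   | no ¬Pb = inj₁ λ Pj → ℕ.≤∧≢⇒< (b≤ Pj) λ { refl → ¬Pb Pj }
... | inj₁ k≤    = k , Pk , k≤
... | inj₂ found = found

Λ-minimum : ∀ {N} (S : Word N) → ∃ (IsMinimum (Height S))
Λ-minimum {N} S = minimum (height? S) (1 ℕ.⊔ v , 1 , + v ,
  ℕ.s≤s ℕ.z≤n , (λ 2∣1 → contradiction (ℕ.∣⇒≤ 2∣1) λ { (ℕ.s≤s ()) }) , 2ᴺ∣0 , refl)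
  where
  v = value S
  2ᴺ∣0 : + (2 ℕ.^ N) ℤ.∣ + 1 ℤ.* + v ℤ.- + v
  2ᴺ∣0 = subst (λ i → + (2 ℕ.^ N) ℤ.∣ i)
    (sym (trans (cong (λ i → i ℤ.- + v) (ℤ.*-identityˡ (+ v))) (ℤ.+-inverseʳ (+ v))))
    ((2 ℕ.^ N) ℕ.∣0)

Λ : ∀ {N} → Word N → ℕ
Λ S = proj₁ (Λ-minimum S)

Λ≢0 : ∀ {N} (S : Word N) → ℕ.NonZero (Λ S)
Λ≢0 S with Λ-minimum S
... | _ , (q , f , 0<q , _ , _ , refl) , _ = ℕ.>-nonZero (ℕ.≤-trans 0<q (ℕ.m≤m⊔n q ℤ.∣ f ∣))

λ₂ : ∀ {N} → Word N → ℝ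
λ₂ S = log₂ (Λ S) {{Λ≢0 S}}

Λˢʸᵐ : ∀ {N} → Word N → ℕ
Λˢʸᵐ S = Λ S ℕ.⊓ Λ (Vec.reverse S)

λ₂ˢʸᵐ : ∀ {N} → Word N → ℝ
λ₂ˢʸᵐ S = λ₂ S ⊓ᴿ λ₂ (Vec.reverse S)

words : ∀ N → List (Word N)
words zero    = [] ∷ []
words (suc N) = cartesianProductWith _∷_ (allFin 2) (words N)

𝔼 : ∀ N → (Word N → ℝ) → ℝ
𝔼 N X = (foldr _+ᴿ_ (ι 0ℚ) (map X (words N)) ÷ᴿ (2 ℕ.^ N)) {{ℕ.m^n≢0 2 N}}

Eʳᵃᵗ⁻ˢʸᵐ : ℕ → ℝ
Eʳᵃᵗ⁻ˢʸᵐ N = 𝔼 N λ S → ι (fromℕ (Λˢʸᵐ S))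

E²⁻ᵃᵈⁱᶜ⁻ˢʸᵐ : ℕ → ℝ
E²⁻ᵃᵈⁱᶜ⁻ˢʸᵐ N = 𝔼 N λ₂ˢʸᵐ

{-# OPTIONS --safe #-}

-- A word S is determined by its length, a pair (q, f) with q odd and q S ≡ f mod 2ᴺ, and
-- the choice between S and its reverse; hence at most 4·4ʲ words satisfy Λˢʸᵐ S < 2ʲ.
-- So half of the words have Λˢʸᵐ S of order 2^(N/2), and summing the counts over j ≤ N/2
-- shows that ⌊log₂ Λˢʸᵐ⌋ has mean at least N/2 - O(1). Both bounds beat the required ones by
-- a quantity tending to infinity, so that the error term may be taken eventually zero.
module Submission where

open import Defs
open import Algebra.Bundles using (CommutativeRing)
import Algebra.Properties.CommutativeSemiring.Exp as Exp
open import Data.Bool.Base using (if_then_else_; true; false)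
open import Data.Fin.Base using (Fin; zero; suc; toℕ; fromℕ<; combine)
import Data.Fin.Properties as Fin
import Data.Integer.Base as ℤ
import Data.Integer.Divisibility.Signed as Signed
import Data.Integer.Properties as ℤ
import Data.Integer.Tactic.RingSolver as ℤ
open import Data.List.Base using (List; []; _∷_; filter; foldr; length; lookup; map)
open import Data.List.Membership.Propositional.Properties using (∈-lookup)
import Data.List.Properties as List
open import Data.List.Relation.Unary.All as All using (All; [])
open import Data.List.Relation.Unary.All.Properties using (all-filter)
open import Data.List.Relation.Unary.AllPairs using ([]; _∷_)
open import Data.List.Relation.Unary.Unique.Propositional using (Unique)
import Data.List.Relation.Unary.Unique.Propositional.Properties as Unique
open import Data.Nat.Base as ℕ using (ℕ; zero; suc; NonTrivial; nonTrivial⇒nonZero)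
open import Data.Nat.ListAction using (sum)
import Data.Nat.Properties as ℕ
open import Data.Nat.Tactic.RingSolver using (solve-∀)
open import Data.Product using (∃; _×_; _,_; proj₁; proj₂)
open import Data.Sign.Base as Sign using (Sign)
open import Data.Sum.Base using (inj₁; inj₂)
open import Data.Vec.Base as Vec using ([]; _∷_)
import Data.Vec.Properties as Vec
open import Function.Base using (_∘_; const)
open import Relation.Binary.PropositionalEquality
open import Relation.Nullary.Decidable.Core using (Dec; yes; no; ¬?)
open import Relation.Nullary.Negation.Core using (¬_; contradiction)
open import Relation.Nullary.Reflects using (ofʸ)

module Counting where
  open import Data.Nat.Base
  open import Data.Nat.Divisibility
  open import Data.Nat.Primality using (euclidsLemma; prime[2])
  open import Data.Nat.Properties

  -- Binary expansions and rational representations.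

  sum-tabulate-*ˡ : ∀ c {n} (f g : Fin n → ℕ) → (∀ i → g i ≡ c * f i) →
                    Vec.sum (Vec.tabulate g) ≡ c * Vec.sum (Vec.tabulate f)
  sum-tabulate-*ˡ c {zero}  f g g≡ = sym (*-zeroʳ c)
  sum-tabulate-*ˡ c {suc n} f g g≡ = trans
    (cong₂ _+_ (g≡ zero) (sum-tabulate-*ˡ c (f ∘ suc) (g ∘ suc) (g≡ ∘ suc)))
    (sym (*-distribˡ-+ c (f zero) _))

  value-∷ : ∀ {N} x (S : Word N) → value (x ∷ S) ≡ toℕ x + 2 * value S
  value-∷ x S = cong₂ _+_ (*-identityʳ (toℕ x)) (sum-tabulate-*ˡ 2
    (λ n → toℕ (Vec.lookup S n) * 2 ^ toℕ n) _ λ n → swap (toℕ (Vec.lookup S n)) (2 ^ toℕ n))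
    where
    swap : ∀ a b → a * (2 * b) ≡ 2 * (a * b)
    swap = solve-∀

  value<2^N : ∀ {N} (S : Word N) → value S < 2 ^ N
  value<2^N []              = z<s
  value<2^N {suc N} (x ∷ S) = begin-strict
    value (x ∷ S)          ≡⟨ value-∷ x S ⟩
    toℕ x + 2 * value S    <⟨ +-monoˡ-< (2 * value S) (Fin.toℕ<n x) ⟩
    2 + 2 * value S        ≡⟨ *-suc 2 (value S) ⟨
    2 * suc (value S)      ≤⟨ *-monoʳ-≤ 2 (value<2^N S) ⟩
    2 ^ suc N              ∎
    where open ≤-Reasoning

  bit+double-injective : ∀ (x y : Fin 2) m n → toℕ x + 2 * m ≡ toℕ y + 2 * n → x ≡ y × m ≡ n
  bit+double-injective zero       zero       m n eq = refl , *-cancelˡ-≡ m n 2 eq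
  bit+double-injective zero       (suc zero) m n eq = contradiction eq (even≢odd m n)
  bit+double-injective (suc zero) zero       m n eq = contradiction (sym eq) (even≢odd n m)
  bit+double-injective (suc zero) (suc zero) m n eq = refl , *-cancelˡ-≡ m n 2 (suc-injective eq)

  -- The parity of the value recovers the first entry, which is the least significant bit; halving
  -- then leaves the value of the tail.
  value-injective : ∀ {N} (S T : Word N) → value S ≡ value T → S ≡ T
  value-injective []      []      _  = refl
  value-injective (x ∷ S) (y ∷ T) eq
    with x≡y , v≡ ← bit+double-injective x y (value S) (value T)
                      (trans (sym (value-∷ x S)) (trans eq (value-∷ y T)))
    = cong₂ _∷_ x≡y (value-injective S T v≡)

  -- As `q` is odd, Euclid's lemma for the prime 2 moves the factors 2 into `m` one at a time. This
  -- takes the place of inverting `q` modulo 2ⁿ.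
  odd∧2^∣*⇒2^∣ : ∀ n {q m} → ¬ 2 ∣ q → 2 ^ n ∣ q * m → 2 ^ n ∣ m
  odd∧2^∣*⇒2^∣ zero            2∤q 1∣qm = 1∣ _
  odd∧2^∣*⇒2^∣ (suc n) {q} {m} 2∤q 2^∣qm
    with euclidsLemma q m prime[2] (∣-trans (m∣m*n (2 ^ n)) 2^∣qm)
  ... | inj₁ 2∣q = contradiction 2∣q 2∤q
  ... | inj₂ (divides m′ refl) = subst (2 ^ suc n ∣_) (*-comm 2 m′) (*-monoʳ-∣ 2
    (odd∧2^∣*⇒2^∣ n 2∤q (*-cancelˡ-∣ 2 (subst (2 ^ suc n ∣_) (swap q m′) 2^∣qm))))
    where
    swap : ∀ q m → q * (m * 2) ≡ 2 * (q * m)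
    swap = solve-∀

  -- A nonzero |m - n| is at most max{m, n} < d, too small to be a multiple of d.
  ∣-∣⇒≡ : ∀ {d m n} → m < d → n < d → d ∣ ℤ.∣ ℤ.+ m ℤ.- ℤ.+ n ∣ → m ≡ n
  ∣-∣⇒≡ {d} {m} {n} m<d n<d d∣ with ℤ.∣ ℤ.+ m ℤ.- ℤ.+ n ∣ in eq
  ... | zero  = ℤ.+-injective (ℤ.i-j≡0⇒i≡j (ℤ.+ m) (ℤ.+ n) (ℤ.∣i∣≡0⇒i≡0 eq))
  ... | suc k = contradiction (∣⇒≤ d∣) (<⇒≱ (begin-strict
    suc k                  ≡⟨ eq ⟨
    ℤ.∣ ℤ.+ m ℤ.- ℤ.+ n ∣  ≡⟨ cong ℤ.∣_∣ (ℤ.m-n≡m⊖n m n) ⟩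
    ℤ.∣ m ℤ.⊖ n ∣          ≤⟨ ℤ.∣m⊝n∣≤m⊔n m n ⟩
    m ⊔ n                  <⟨ ⊔-lub m<d n<d ⟩
    d                      ∎))
    where open ≤-Reasoning

  -- Subtracting the congruences qs ≡ f and qt ≡ f shows that 2ᴺ divides q(s - t). Oddness of q
  -- removes the factor q, and both values lie below 2ᴺ.
  Represents-injective : ∀ {N} {S T : Word N} {k l q f} →
                         Represents S k q f → Represents T l q f → S ≡ T
  Represents-injective {N} {S} {T} {q = q} {f} (_ , 2∤q , dS , _) (_ , _ , dT , _) =
    value-injective S T (∣-∣⇒≡ (value<2^N S) (value<2^N T)
      (odd∧2^∣*⇒2^∣ N 2∤q (subst (2 ^ N ∣_) ∣q[s-t]∣ (Signed.∣⇒∣ᵤ (Signed.∣m∣n⇒∣m-n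
        (Signed.∣ᵤ⇒∣ {ℤ.+ (2 ^ N)} {ℤ.+ q ℤ.* ℤ.+ s ℤ.- f} dS)
        (Signed.∣ᵤ⇒∣ {ℤ.+ (2 ^ N)} {ℤ.+ q ℤ.* ℤ.+ t ℤ.- f} dT))))))
    where
    s = value S
    t = value T
    cancel : ∀ q s t f → (q ℤ.* s ℤ.- f) ℤ.- (q ℤ.* t ℤ.- f) ≡ q ℤ.* (s ℤ.- t)
    cancel = ℤ.solve-∀
    ∣q[s-t]∣ : ℤ.∣ (ℤ.+ q ℤ.* ℤ.+ s ℤ.- f) ℤ.- (ℤ.+ q ℤ.* ℤ.+ t ℤ.- f) ∣ ≡ q * ℤ.∣ ℤ.+ s ℤ.- ℤ.+ t ∣
    ∣q[s-t]∣ = trans (cong ℤ.∣_∣ (cancel (ℤ.+ q) (ℤ.+ s) (ℤ.+ t) f)) (ℤ.abs-* (ℤ.+ q) (ℤ.+ s ℤ.- ℤ.+ t))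

  -- Encoding words of small symmetric complexity.

  Unique⇒lookup-injective : ∀ {A : Set} {xs : List A} → Unique xs →
                            ∀ i j → lookup xs i ≡ lookup xs j → i ≡ j
  Unique⇒lookup-injective (x∉ ∷ xs!) zero    zero    eq = refl
  Unique⇒lookup-injective (x∉ ∷ xs!) zero    (suc j) eq = contradiction eq (All.lookup x∉ (∈-lookup j))
  Unique⇒lookup-injective (x∉ ∷ xs!) (suc i) zero    eq = contradiction (sym eq) (All.lookup x∉ (∈-lookup i))
  Unique⇒lookup-injective (x∉ ∷ xs!) (suc i) (suc j) eq = cong suc (Unique⇒lookup-injective xs! i j eq)

  -- Pigeonhole: choosing a code for each position of the list gives a map into `Fin n`, injective
  -- because the entries are distinct and a code belongs to only one element.
  length≤codes : ∀ {A : Set} {n} {P : A → Set} (R : A → Fin n → Set) →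
                 (∀ {x} → P x → ∃ (R x)) → (∀ {x y c} → R x c → R y c → x ≡ y) →
                 ∀ {xs} → Unique xs → All P xs → length xs ≤ n
  length≤codes R code inj {xs} xs! Pxs = Fin.injective⇒≤ {f = proj₁ ∘ codeᵢ} λ {i} {j} cᵢ≡cⱼ →
    Unique⇒lookup-injective xs! i j
      (inj (proj₂ (codeᵢ i)) (subst (R (lookup xs j)) (sym cᵢ≡cⱼ) (proj₂ (codeᵢ j))))
    where
    codeᵢ : ∀ i → ∃ (R (lookup xs i))
    codeᵢ i = code (All.lookup Pxs (∈-lookup i))

  words-unique : ∀ N → Unique (words N)
  words-unique zero    = [] ∷ []
  words-unique (suc N) = Unique.cartesianProductWith⁺ _∷_ Vec.∷-injective (Unique.allFin⁺ 2) (words-unique N)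

  length-words : ∀ N → length (words N) ≡ 2 ^ N
  length-words zero    = refl
  length-words (suc N) = trans (List.length-++ (map (zero ∷_) W)) (cong₂ _+_ (length-half zero)
    (trans (List.length-++ (map (suc zero ∷_) W)) (cong (_+ 0) (length-half (suc zero)))))
    where
    W = words N
    length-half : ∀ x → length (map (x ∷_) W) ≡ 2 ^ N
    length-half x = trans (List.length-map (x ∷_) W) (length-words N)

  orient : ∀ {N} → Fin 2 → Word N → Word N
  orient zero       S = S
  orient (suc zero) S = Vec.reverse S

  orient-injective : ∀ {N} o {S T : Word N} → orient o S ≡ orient o T → S ≡ T
  orient-injective zero       eq = eq
  orient-injective (suc zero) eq = Vec.reverse-injective eq

  signBit : Sign → Fin 2
  signBit Sign.+ = zero
  signBit Sign.- = suc zero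

  signBit-injective : ∀ s t → signBit s ≡ signBit t → s ≡ t
  signBit-injective Sign.+ Sign.+ _ = refl
  signBit-injective Sign.- Sign.- _ = refl

  module _ {N : ℕ} (B : ℕ) where

    -- A word with Λˢʸᵐ < B is determined by an orientation and a pair (q, f) with q, |f| < B,
    -- the sign of f being stored separately. Oddness of q is not counted, which only costs a factor 2.
    data HasCode (S : Word N) : Fin (2 * (B * (2 * B))) → Set where
      hasCode : ∀ o {k q f} → Represents (orient o S) k q f → (q<B : q < B) (∣f∣<B : ℤ.∣ f ∣ < B) →
                HasCode S (combine o (combine (fromℕ< q<B) (combine (signBit (ℤ.sign f)) (fromℕ< ∣f∣<B))))

    Λ<⇒code : ∀ o {S} → Λ (orient o S) < B → ∃ (HasCode S)
    Λ<⇒code o {S} Λ<B with Λ-minimum (orient o S)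
    ... | k , (q , f , rep@(_ , _ , _ , refl)) , _ = _ , hasCode o {k} {q} {f} rep
      (≤-<-trans (m≤m⊔n q ℤ.∣ f ∣) Λ<B) (≤-<-trans (m≤n⊔m q ℤ.∣ f ∣) Λ<B)

    Λˢʸᵐ<⇒code : ∀ {S} → Λˢʸᵐ S < B → ∃ (HasCode S)
    Λˢʸᵐ<⇒code {S} Λ<B with ⊓-sel (Λ S) (Λ (Vec.reverse S))
    ... | inj₁ eq = Λ<⇒code zero {S} (subst (_< B) eq Λ<B)
    ... | inj₂ eq = Λ<⇒code (suc zero) {S} (subst (_< B) eq Λ<B)

    -- Matching cannot invert an index built by `combine`, so the two codes stay apart and their
    -- equation is unpacked by injectivity of `combine`, yielding orientation, q, sign and |f| in
    -- turn.
    code-injective : ∀ {S T c d} → HasCode S c → HasCode T d → c ≡ d → S ≡ T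
    code-injective (hasCode o {q = q} {f} repS q<B f<B) (hasCode o′ {q = q′} {f′} repT q′<B f′<B) eq
      with refl , eq ← Fin.combine-injective o _ o′ _ eq
      with q≡ , eq ← Fin.combine-injective (fromℕ< q<B) _ (fromℕ< q′<B) _ eq
      with s≡ , f≡ ← Fin.combine-injective (signBit (ℤ.sign f)) _ (signBit (ℤ.sign f′)) _ eq
      with refl ← Fin.fromℕ<-injective q q′ q<B q′<B q≡
      with refl ← ℤ.◃-cong {f} {f′} (signBit-injective _ _ s≡) (Fin.fromℕ<-injective _ _ f<B f′<B f≡)
      = orient-injective o (Represents-injective {f = f} repS repT)

  -- Counting words above a threshold.

  χ : ℕ → ℕ → ℕ
  χ b n = if b ≤ᵇ n then 1 else 0

  length≤Σχ+#< : ∀ {A : Set} b (g : A → ℕ) as →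
                  length as ≤ sum (map (χ b ∘ g) as) + length (filter (λ a → ¬? (b ≤? g a)) as)
  length≤Σχ+#< b g []       = z≤n
  -- Both `χ` and the decision inside `filter` reduce to this Boolean, so a single split settles the
  -- two together.
  length≤Σχ+#< b g (a ∷ as) with b ≤ᵇ g a
  ... | true  = s≤s (length≤Σχ+#< b g as)
  ... | false = subst (suc (length as) ≤_) (sym (+-suc _ _)) (s≤s (length≤Σχ+#< b g as))

  #Λˢʸᵐ<b≤4b² : ∀ N b → length (filter (λ S → ¬? (b ≤? Λˢʸᵐ S)) (words N)) ≤ 2 * (b * (2 * b))
  #Λˢʸᵐ<b≤4b² N b = length≤codes (HasCode b) (λ {S} b≰ → Λˢʸᵐ<⇒code b {S} (≰⇒> b≰))
    (λ c d → code-injective b c d refl)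
    (Unique.filter⁺ small? (words-unique N)) (all-filter small? (words N))
    where
    small? = λ (S : Word N) → ¬? (b ≤? Λˢʸᵐ S)

  2^N≤Σχ+4*4^j : ∀ N j → 2 ^ N ≤ sum (map (χ (2 ^ j) ∘ Λˢʸᵐ) (words N)) + 4 * 4 ^ j
  2^N≤Σχ+4*4^j N j = begin
    2 ^ N                               ≡⟨ length-words N ⟨
    length (words N)                    ≤⟨ length≤Σχ+#< (2 ^ j) Λˢʸᵐ (words N) ⟩
    Σχ + length (filter _ (words N))    ≤⟨ +-monoʳ-≤ Σχ (#Λˢʸᵐ<b≤4b² N (2 ^ j)) ⟩
    Σχ + 2 * (2 ^ j * (2 * 2 ^ j))      ≡⟨ cong (Σχ +_) (trans (regroup (2 ^ j)) (cong (4 *_) (sym (4^≡2^*2^ j)))) ⟩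
    Σχ + 4 * 4 ^ j                      ∎
    where
    open ≤-Reasoning
    Σχ = sum (map (χ (2 ^ j) ∘ Λˢʸᵐ) (words N))
    regroup : ∀ b → 2 * (b * (2 * b)) ≡ 4 * (b * b)
    regroup = solve-∀
    4^≡2^*2^ : ∀ j → 4 ^ j ≡ 2 ^ j * 2 ^ j
    4^≡2^*2^ j = trans (^-*-assoc 2 2 j) (trans (cong (2 ^_) (cong (j +_) (+-identityʳ j))) (^-distribˡ-+-* 2 j j))

  -- Integer minorants of `Λˢʸᵐ` and of its binary logarithm.

  sum-map-*ˡ : ∀ {A : Set} c (g : A → ℕ) as → sum (map (λ a → c * g a) as) ≡ c * sum (map g as)
  sum-map-*ˡ c g []       = sym (*-zeroʳ c)
  sum-map-*ˡ c g (a ∷ as) = trans (cong (c * g a +_) (sum-map-*ˡ c g as)) (sym (*-distribˡ-+ c (g a) _))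

  sum-map-+ : ∀ {A : Set} (g h : A → ℕ) as → sum (map (λ a → g a + h a) as) ≡ sum (map g as) + sum (map h as)
  sum-map-+ g h []       = refl
  sum-map-+ g h (a ∷ as) = trans (cong (g a + h a +_) (sum-map-+ g h as)) (interchange (g a) (h a) _ _)
    where
    interchange : ∀ a b c d → a + b + (c + d) ≡ a + c + (b + d)
    interchange = solve-∀

  sum-map-1 : ∀ {A : Set} (as : List A) → sum (map (const 1) as) ≡ length as
  sum-map-1 []       = refl
  sum-map-1 (a ∷ as) = cong suc (sum-map-1 as)

  1≤Λˢʸᵐ : ∀ {N} (S : Word N) → 1 ≤ Λˢʸᵐ S
  1≤Λˢʸᵐ S = ⊓-glb (>-nonZero⁻¹ _ {{Λ≢0 S}}) (>-nonZero⁻¹ _ {{Λ≢0 (Vec.reverse S)}})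

  4^≡2^2* : ∀ n → 4 ^ n ≡ 2 ^ (2 * n)
  4^≡2^2* = ^-*-assoc 2 2

  -- For k > 0, g is 2ᵏ⁺¹ on the words with 2ᵏ⁺¹ ≤ Λˢʸᵐ S, at least half of all, and 0 elsewhere.
  ∃minorant : ∀ N k → 2 * k ≤ N ∸ 5 → ∃ λ (g : Word N → ℕ) →
             (∀ S → g S ≤ Λˢʸᵐ S) × 2 ^ k * 2 ^ N ≤ sum (map g (words N))
  -- For k = 0 the hypothesis allows N < 5, where the counting bound below is too weak; the constant
  -- 1 already has the required mean.
  ∃minorant N zero _ = const 1 , 1≤Λˢʸᵐ ,
    ≤-reflexive (trans (*-identityˡ (2 ^ N)) (sym (trans (sum-map-1 (words N)) (length-words N))))
  ∃minorant N k@(suc _) 2k≤N∸5 =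
    (λ S → 2 ^ suc k * χ (2 ^ suc k) (Λˢʸᵐ S)) , (λ S → *χ≤ (2 ^ suc k) (Λˢʸᵐ S)) , (begin
    2 ^ k * 2 ^ N         ≤⟨ *-monoʳ-≤ (2 ^ k) half ⟩
    2 ^ k * (2 * Σχ)      ≡⟨ regroup (2 ^ k) Σχ ⟩
    2 ^ suc k * Σχ        ≡⟨ sum-map-*ˡ (2 ^ suc k) (χ (2 ^ suc k) ∘ Λˢʸᵐ) (words N) ⟨
    sum (map (λ S → 2 ^ suc k * χ (2 ^ suc k) (Λˢʸᵐ S)) (words N)) ∎)
    where
    open ≤-Reasoning
    Σχ = sum (map (χ (2 ^ suc k) ∘ Λˢʸᵐ) (words N))
    regroup : ∀ a b → a * (2 * b) ≡ 2 * a * b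
    regroup = solve-∀
    *χ≤ : ∀ b n → b * χ b n ≤ n
    *χ≤ b n with b ≤ᵇ n | ≤ᵇ-reflects-≤ b n
    ... | true  | ofʸ b≤n = ≤-trans (≤-reflexive (*-identityʳ b)) b≤n
    ... | false | _       = ≤-trans (≤-reflexive (*-zeroʳ b)) z≤n
    -- A positive k makes N ∸ 5 positive, so nothing is truncated.
    5≤N : 5 ≤ N
    5≤N = <⇒≤ (m∸n≢0⇒n<m λ N∸5≡0 → contradiction (≤-trans 2k≤N∸5 (≤-reflexive N∸5≡0)) λ ())
    -- At most 4·4ᵏ⁺¹ words lie below 2ᵏ⁺¹. For this bound to be at most half of 2ᴺ one needs 2k + 5
    -- ≤ N, which is where the 5 comes from.
    few : 2 * (4 * 4 ^ suc k) ≤ 2 ^ N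
    few = begin
      2 * (4 ^ suc (suc k))             ≡⟨ cong (2 *_) (4^≡2^2* (suc (suc k))) ⟩
      2 ^ suc (2 * suc (suc k))         ≤⟨ ^-monoʳ-≤ 2 (begin
        suc (2 * suc (suc k))           ≡⟨ shift k ⟩
        2 * k + 5                       ≤⟨ +-monoˡ-≤ 5 2k≤N∸5 ⟩
        N ∸ 5 + 5                       ≡⟨ m∸n+n≡m 5≤N ⟩
        N                               ∎) ⟩
      2 ^ N                             ∎
      where
      shift : ∀ k → suc (2 * suc (suc k)) ≡ 2 * k + 5
      shift = solve-∀
    half : 2 ^ N ≤ 2 * Σχ
    half = +-cancelʳ-≤ (2 ^ N) (2 ^ N) (2 * Σχ) (begin
      2 ^ N + 2 ^ N                    ≡⟨ cong (2 ^ N +_) (+-identityʳ (2 ^ N)) ⟨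
      2 * 2 ^ N                        ≤⟨ *-monoʳ-≤ 2 (2^N≤Σχ+4*4^j N (suc k)) ⟩
      2 * (Σχ + 4 * 4 ^ suc k)         ≡⟨ *-distribˡ-+ 2 Σχ (4 * 4 ^ suc k) ⟩
      2 * Σχ + 2 * (4 * 4 ^ suc k)     ≤⟨ +-monoʳ-≤ (2 * Σχ) few ⟩
      2 * Σχ + 2 ^ N                   ∎)

  -- The number of j ∈ {1, …, J} with 2ʲ ≤ n, that is, min{J, ⌊log₂ n⌋} for n > 0.
  levels : ℕ → ℕ → ℕ
  levels zero    n = 0
  levels (suc J) n = χ (2 ^ suc J) n + levels J n

  levels≤ : ∀ J n → levels J n ≤ J
  levels≤ zero    n = z≤n
  levels≤ (suc J) n with 2 ^ suc J ≤ᵇ n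
  ... | true  = s≤s (levels≤ J n)
  ... | false = m≤n⇒m≤1+n (levels≤ J n)

  -- If the top level counts, then 2ᴶ⁺¹ ≤ n, and the number of levels is at most J + 1 in any case;
  -- otherwise the top level adds nothing and induction applies.
  2^levels≤ : ∀ J n .{{_ : NonZero n}} → 2 ^ levels J n ≤ n
  2^levels≤ zero    n = >-nonZero⁻¹ n
  2^levels≤ (suc J) n with 2 ^ suc J ≤ᵇ n | ≤ᵇ-reflects-≤ (2 ^ suc J) n
  ... | true  | ofʸ 2^J≤n = ≤-trans (^-monoʳ-≤ 2 (s≤s (levels≤ J n))) 2^J≤n
  ... | false | _         = 2^levels≤ J n

  -- The threshold counts for the levels up to J are added by induction, the errors forming a
  -- geometric sum. The step needs 16 + c ≤ 4c for the constant c, and 6 is the least such integer.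
  J*2^N≤Σlevels+6*4^J : ∀ N J → J * 2 ^ N ≤ sum (map (levels J ∘ Λˢʸᵐ) (words N)) + 6 * 4 ^ J
  J*2^N≤Σlevels+6*4^J N zero    = z≤n
  J*2^N≤Σlevels+6*4^J N (suc J) = begin
    2 ^ N + J * 2 ^ N                          ≤⟨ +-mono-≤ (2^N≤Σχ+4*4^j N (suc J)) (J*2^N≤Σlevels+6*4^J N J) ⟩
    Σχ + 4 * 4 ^ suc J + (Σℓ + 6 * 4 ^ J)      ≡⟨ regroup Σχ Σℓ (4 ^ J) ⟩
    Σχ + Σℓ + 22 * 4 ^ J                       ≤⟨ +-monoʳ-≤ (Σχ + Σℓ) (*-monoˡ-≤ (4 ^ J) (m≤n+m 22 2)) ⟩
    Σχ + Σℓ + 24 * 4 ^ J                       ≡⟨ cong₂ _+_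
                                                    (sum-map-+ (χ (2 ^ suc J) ∘ Λˢʸᵐ) (levels J ∘ Λˢʸᵐ) (words N))
                                                    (sym (*-assoc 6 4 (4 ^ J))) ⟨
    sum (map (levels (suc J) ∘ Λˢʸᵐ) (words N)) + 6 * 4 ^ suc J ∎
    where
    open ≤-Reasoning
    Σχ = sum (map (χ (2 ^ suc J) ∘ Λˢʸᵐ) (words N))
    Σℓ = sum (map (levels J ∘ Λˢʸᵐ) (words N))
    regroup : ∀ a b c → a + 4 * (4 * c) + (b + 6 * c) ≡ a + b + 22 * c
    regroup = solve-∀

  -- Since 2J ≤ N gives 4ᴶ ≤ 2ᴺ, the error 6·4ᴶ costs at most 6 per word on average.
  ∃log-minorant : ∀ N J → 2 * J ≤ N → ∃ λ (g : Word N → ℕ) →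
                 (∀ S → 2 ^ g S ≤ Λˢʸᵐ S) × (J ∸ 6) * 2 ^ N ≤ sum (map g (words N))
  ∃log-minorant N J 2J≤N = levels J ∘ Λˢʸᵐ ,
    (λ S → 2^levels≤ J (Λˢʸᵐ S) {{>-nonZero (1≤Λˢʸᵐ S)}}) , (begin
    (J ∸ 6) * 2 ^ N            ≡⟨ *-distribʳ-∸ (2 ^ N) J 6 ⟩
    J * 2 ^ N ∸ 6 * 2 ^ N      ≤⟨ m≤n+o⇒m∸n≤o (J * 2 ^ N) (6 * 2 ^ N) (begin
      J * 2 ^ N                  ≤⟨ J*2^N≤Σlevels+6*4^J N J ⟩
      Σℓ + 6 * 4 ^ J             ≤⟨ +-monoʳ-≤ Σℓ (*-monoʳ-≤ 6 (subst (_≤ 2 ^ N) (sym (4^≡2^2* J)) (^-monoʳ-≤ 2 2J≤N))) ⟩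
      Σℓ + 6 * 2 ^ N             ≡⟨ +-comm Σℓ (6 * 2 ^ N) ⟩
      6 * 2 ^ N + Σℓ             ∎) ⟩
    Σℓ                         ∎)
    where
    open ≤-Reasoning
    Σℓ = sum (map (levels J ∘ Λˢʸᵐ) (words N))

  -- Rounding N/2 down to an integer.

  2⌊n/2⌋≤n : ∀ n → 2 * ⌊ n /2⌋ ≤ n
  2⌊n/2⌋≤n zero          = z≤n
  2⌊n/2⌋≤n (suc zero)    = z≤n
  2⌊n/2⌋≤n (suc (suc n)) = ≤-trans (≤-reflexive (*-suc 2 ⌊ n /2⌋)) (s≤s (s≤s (2⌊n/2⌋≤n n)))

  n≤1+2⌊n/2⌋ : ∀ n → n ≤ 1 + 2 * ⌊ n /2⌋
  n≤1+2⌊n/2⌋ zero          = z≤n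
  n≤1+2⌊n/2⌋ (suc zero)    = ≤-refl
  n≤1+2⌊n/2⌋ (suc (suc n)) = ≤-trans (s≤s (s≤s (n≤1+2⌊n/2⌋ n)))
    (≤-reflexive (cong suc (sym (*-suc 2 ⌊ n /2⌋))))

  -- The subtraction loses at most 5 and the halving at most 1, so 3 = (5 + 1)/2 repairs both.
  n≤2[⌊[n∸5]/2⌋+3] : ∀ n → n ≤ 2 * (⌊ n ∸ 5 /2⌋ + 3)
  n≤2[⌊[n∸5]/2⌋+3] n = begin
    n                             ≤⟨ m≤n+m∸n n 5 ⟩
    5 + (n ∸ 5)                   ≤⟨ +-monoʳ-≤ 5 (n≤1+2⌊n/2⌋ (n ∸ 5)) ⟩
    6 + 2 * ⌊ n ∸ 5 /2⌋           ≡⟨ regroup ⌊ n ∸ 5 /2⌋ ⟩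
    2 * (⌊ n ∸ 5 /2⌋ + 3)         ∎
    where
    open ≤-Reasoning
    regroup : ∀ k → 6 + 2 * k ≡ 2 * (k + 3)
    regroup = solve-∀

  -- The halving loses at most 1, rounded up to 2, and the subtraction at most 6 after halving: 7 =
  -- (2 + 12)/2.
  n≤2[⌊n/2⌋∸6+7] : ∀ n → n ≤ 2 * (⌊ n /2⌋ ∸ 6 + 7)
  n≤2[⌊n/2⌋∸6+7] n = begin
    n                             ≤⟨ n≤1+2⌊n/2⌋ n ⟩
    1 + 2 * ⌊ n /2⌋               ≤⟨ +-mono-≤ (n≤1+n 1) (*-monoʳ-≤ 2 (m≤n+m∸n ⌊ n /2⌋ 6)) ⟩
    2 + 2 * (6 + (⌊ n /2⌋ ∸ 6))   ≡⟨ regroup (⌊ n /2⌋ ∸ 6) ⟩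
    2 * (⌊ n /2⌋ ∸ 6 + 7)         ∎
    where
    open ≤-Reasoning
    regroup : ∀ k → 2 + 2 * (6 + k) ≡ 2 * (k + 7)
    regroup = solve-∀

open Counting using (∃minorant; ∃log-minorant; 2⌊n/2⌋≤n; n≤2[⌊[n∸5]/2⌋+3]; n≤2[⌊n/2⌋∸6+7])

open import Data.Integer.Base using (+_)
open import Data.Rational.Base
open import Data.Rational.Properties
open import Data.Rational.Solver using (module +-*-Solver)
open import Data.Rational.Unnormalised.Base using (mkℚᵘ; *≤*)
import Data.Rational.Unnormalised.Properties as ℚᵘ

open Exp (CommutativeRing.commutativeSemiring +-*-commutativeRing) using (_^_)
open +-*-Solver using (solve; _:=_; _:+_; _:*_; :-_; con)
open ℝ

-- Natural numbers inside the rationals.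

fromℕ-+ : ∀ m n → fromℕ (m ℕ.+ n) ≡ fromℕ m + fromℕ n
fromℕ-+ zero    n = sym (+-identityˡ (fromℕ n))
fromℕ-+ (suc m) n = begin
  fromℕ (suc (m ℕ.+ n))      ≡⟨ fromℕ-suc (m ℕ.+ n) ⟩
  1ℚ + fromℕ (m ℕ.+ n)       ≡⟨ cong (λ t → 1ℚ + t) (fromℕ-+ m n) ⟩
  1ℚ + (fromℕ m + fromℕ n)   ≡⟨ +-assoc 1ℚ (fromℕ m) (fromℕ n) ⟨
  1ℚ + fromℕ m + fromℕ n     ≡⟨ cong (_+ fromℕ n) (fromℕ-suc m) ⟨
  fromℕ (suc m) + fromℕ n    ∎
  where open ≡-Reasoning

fromℕ-* : ∀ m n → fromℕ (m ℕ.* n) ≡ fromℕ m * fromℕ n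
fromℕ-* zero    n = sym (*-zeroˡ (fromℕ n))
fromℕ-* (suc m) n = begin
  fromℕ (n ℕ.+ m ℕ.* n)         ≡⟨ fromℕ-+ n (m ℕ.* n) ⟩
  fromℕ n + fromℕ (m ℕ.* n)     ≡⟨ cong (λ t → fromℕ n + t) (fromℕ-* m n) ⟩
  fromℕ n + fromℕ m * fromℕ n   ≡⟨ solve 2 (λ m n → n :+ m :* n := (con 1ℚ :+ m) :* n) refl (fromℕ m) (fromℕ n) ⟩
  (1ℚ + fromℕ m) * fromℕ n      ≡⟨ cong (_* fromℕ n) (fromℕ-suc m) ⟨
  fromℕ (suc m) * fromℕ n       ∎
  where open ≡-Reasoning

fromℕ-2^ : ∀ n → fromℕ (2 ℕ.^ n) ≡ 2ℚ ^ n
fromℕ-2^ zero    = refl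
fromℕ-2^ (suc n) = trans (fromℕ-* 2 (2 ℕ.^ n)) (cong (2ℚ *_) (fromℕ-2^ n))

-- Passing to the unnormalised fraction n/2 avoids the reduction to lowest terms in `+ n / 2`.
n≤2m⇒n/2≤m : ∀ {m n} → n ℕ.≤ 2 ℕ.* m → + n / 2 ≤ fromℕ m
n≤2m⇒n/2≤m {m} {n} n≤2m = toℚᵘ-cancel-≤ (ℚᵘ.≤-trans
  (ℚᵘ.≤-reflexive (toℚᵘ-fromℚᵘ (mkℚᵘ (+ n) 1)))
  (*≤* (subst₂ ℤ._≤_ (sym (ℤ.*-identityʳ (+ n))) (ℤ.pos-* m 2)
    (ℤ.+≤+ (subst (n ℕ.≤_) (ℕ.*-comm 2 m) n≤2m)))))

-- Comparing reals with rationals.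

<⇒lower⇒ι≤ : ∀ {a x} → (∀ {q} → q < a → lower x q) → ι a ≤ᴿ x
<⇒lower⇒ι≤ below q (_ , q<p , p≤a) = below (<-≤-trans q<p p≤a)

ι≤⇒<⇒lower : ∀ {a x} → ι a ≤ᴿ x → ∀ {q} → q < a → lower x q
ι≤⇒<⇒lower {a} a≤x q<a = a≤x _ (a , q<a , ≤-refl)

lower⇒<⇒≤ι : ∀ {x a} → (∀ {q} → lower x q → q < a) → x ≤ᴿ ι a
lower⇒<⇒≤ι {a = a} below q Lq = a , below Lq , ≤-refl

≤ι⇒lower⇒< : ∀ {x a} → x ≤ᴿ ι a → ∀ {q} → lower x q → q < a
≤ι⇒lower⇒< x≤a Lq with x≤a _ Lq
... | _ , q<p , p≤a = <-≤-trans q<p p≤a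

≤ᴿ-trans : ∀ {x y z} → x ≤ᴿ y → y ≤ᴿ z → x ≤ᴿ z
≤ᴿ-trans x≤y y≤z q = y≤z q ∘ x≤y q

ι-mono : ∀ {a b} → a ≤ b → ι a ≤ᴿ ι b
ι-mono a≤b q (p , q<p , p≤a) = p , q<p , ≤-trans p≤a a≤b

ι≤+ : ∀ {a b x y} → ι a ≤ᴿ x → ι b ≤ᴿ y → ι (a + b) ≤ᴿ x +ᴿ y
ι≤+ {a} {b} {x} {y} a≤x b≤y = <⇒lower⇒ι≤ {a + b} {x +ᴿ y} λ {q} q<a+b →
  let (p , q<p , p<a+b) = <-dense q<a+b
      -- Only rationals strictly below a and b are known to lie in the lower cuts, so the gap a + b
      -- - p is shared evenly between the summands.
      d = ½ * (a + b - p)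
      0<d = *-pos (½^-pos 1) (<⇒0<- p<a+b)
  in p , q<p , a - d , b - d , ι≤⇒<⇒lower {a} {x} a≤x (p-d<p a 0<d) , ι≤⇒<⇒lower {b} {y} b≤y (p-d<p b 0<d) ,
     ≤-reflexive (solve 3 (λ a b p → p := (a :+ :- (con ½ :* (a :+ b :+ :- p))) :+ (b :+ :- (con ½ :* (a :+ b :+ :- p)))) refl a b p)
  where
  p-d<p : ∀ p {d} → 0ℚ < d → p - d < p
  p-d<p p {d} 0<d = subst (p - d <_) (+-identityʳ p) (+-monoʳ-< p (neg-antimono-< 0<d))

+≤ι : ∀ {a b x y} → x ≤ᴿ ι a → y ≤ᴿ ι b → x +ᴿ y ≤ᴿ ι (a + b)
+≤ι {a} {b} {x} {y} x≤a y≤b = lower⇒<⇒≤ι {x +ᴿ y} {a + b} λ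
  { (p , q<p , c , d , Lc , Ld , p≤) → <-≤-trans q<p (≤-trans p≤
      (+-mono-≤ (<⇒≤ (≤ι⇒lower⇒< {x} {a} x≤a Lc)) (<⇒≤ (≤ι⇒lower⇒< {y} {b} y≤b Ld)))) }

-- An upper bound of `x` cannot be less than a, by `ordered`. Openness of the upper cut supplies one
-- strictly below -q, which makes the inequality strict.
-≤ι : ∀ {a x} → ι a ≤ᴿ x → -ᴿ x ≤ᴿ ι (- a)
-≤ι {a} {x} a≤x = lower⇒<⇒≤ι { -ᴿ x} { - a} bounded
  where
  bounded : ∀ {q} → upper x (- q) → q < - a
  bounded {q} U with openᵁ x U
  ... | u , u<-q , Uu = subst (_< - a) (neg-involutive q) (neg-antimono-<
    (≤-<-trans (≮⇒≥ λ u<a → <-irrefl refl (ordered x (ι≤⇒<⇒lower {a} {x} a≤x u<a) Uu)) u<-q))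

x-x≤0 : ∀ x → x +ᴿ (-ᴿ x) ≤ᴿ ι 0ℚ
x-x≤0 x = lower⇒<⇒≤ι {x +ᴿ (-ᴿ x)} {0ℚ} λ { {q} (p , q<p , c , d , Lc , Ud , p≤) →
  <-trans (<-≤-trans q<p p≤) (subst (c + d <_) (+-inverseˡ d)
    (+-monoˡ-< d (ordered x Lc Ud))) }

ι≤⊓ : ∀ {a x y} → ι a ≤ᴿ x → ι a ≤ᴿ y → ι a ≤ᴿ x ⊓ᴿ y
ι≤⊓ a≤x a≤y q L = a≤x q L , a≤y q L

ι≤÷ : ∀ {a x} n .{{_ : ℕ.NonZero n}} → ι (a * fromℕ n) ≤ᴿ x → ι a ≤ᴿ x ÷ᴿ n
ι≤÷ {a} {x} n@(suc _) a*n≤x = <⇒lower⇒ι≤ {a} {x ÷ᴿ n} λ q<a →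
  ι≤⇒<⇒lower {a * fromℕ n} {x} a*n≤x (*-monoˡ-<-pos (fromℕ n) q<a)

-- Powers of two and logarithms.

2^-mono-≤ι : ∀ {x} n → x ≤ᴿ ι (fromℕ n) → 2^ x ≤ᴿ ι (2ℚ ^ n)
2^-mono-≤ι {x} n x≤n = lower⇒<⇒≤ι {2^ x} {2ℚ ^ n} bounded
  where
  bounded : ∀ {q} → lower (2^ x) q → q < 2ℚ ^ n
  bounded (y , q<y , inj₁ y≤0) = <-≤-trans q<y (≤-trans y≤0 (<⇒≤ (2^ℤ-pos (+ n))))
  bounded (y , q<y , inj₂ (p , Lp , y≤2^p)) = <-≤-trans q<y (y≤ (y ≤? 0ℚ))
    where
    y≤ : Dec (y ≤ 0ℚ) → y ≤ 2ℚ ^ n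
    y≤ (yes y≤0) = ≤-trans y≤0 (<⇒≤ (2^ℤ-pos (+ n)))
    -- Weakening the exponent from p to n needs y ≥ 0, whence the case split. As `fromℕ n` has
    -- denominator 1, the weakened bound reads y · 1 ≤ 2ⁿ.
    y≤ (no  y≰0) = subst (_≤ 2ℚ ^ n) (*-identityʳ y)
      (≤2^-weaken {y} {p} {fromℕ n} (<⇒≤ (≰⇒> y≰0)) (<⇒≤ (≤ι⇒lower⇒< {x} {fromℕ n} x≤n Lp)) y≤2^p)

2^m≤n⇒m≤log₂n : ∀ m n .{{_ : ℕ.NonZero n}} → 2 ℕ.^ m ℕ.≤ n → ι (fromℕ m) ≤ᴿ log₂ n
2^m≤n⇒m≤log₂n m n 2^m≤n = <⇒lower⇒ι≤ {fromℕ m} {log₂ n} λ q<m →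
  fromℕ m , q<m , subst₂ _≤_ (fromℕ-2^ m) (sym (*-identityʳ (fromℕ n))) (fromℕ-mono 2^m≤n)

-- 1 - m/2ᵏ ≥ ½ for k = m + 1, so e⁻ᵐ ≥ ½^(2ᵏ).
2^2^[1+m]≤n⇒m≤logn : ∀ m n .{{_ : ℕ.NonZero n}} → 2 ℕ.^ (2 ℕ.^ suc m) ℕ.≤ n → ι (fromℕ m) ≤ᴿ log n
2^2^[1+m]≤n⇒m≤logn m n n≥ = <⇒lower⇒ι≤ {fromℕ m} {log n} λ q<m →
  fromℕ m , q<m , suc m , <-≤-trans (½^-pos 1) ½≤u , (begin
    1ℚ                        ≡⟨ ½^*2^ K ⟨
    ½ ^ K * 2ℚ ^ K            ≡⟨ *-comm (½ ^ K) (2ℚ ^ K) ⟩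
    2ℚ ^ K * ½ ^ K            ≤⟨ *-mono (<⇒≤ (2^ℤ-pos (+ K))) (^-nonNeg K (≤-trans (<⇒≤ (½^-pos 1)) ½≤u))
                                   (subst (_≤ fromℕ n) (fromℕ-2^ K) (fromℕ-mono n≥))
                                   (^-mono K (<⇒≤ (½^-pos 1)) ½≤u) ⟩
    fromℕ n * u ^ K           ∎)
  where
  open ≤-Reasoning
  K = 2 ℕ.^ suc m
  u = 1+ - fromℕ m /2^ suc m
  ½≤u : ½ ≤ u
  ½≤u = begin
    ½                             ≡⟨⟩
    1ℚ + ½ * - 1ℚ                 ≤⟨ +-monoʳ-≤ 1ℚ (*-monoʳ (<⇒≤ (½^-pos 1)) (neg-antimono-≤ (<⇒≤ (½^k*k<1 m)))) ⟩
    1ℚ + ½ * - (½ ^ m * fromℕ m)  ≡⟨ solve 2 (λ h m → con 1ℚ :+ con ½ :* (:- (h :* m))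
                                       := con 1ℚ :+ con ½ :* h :* (:- m)) refl (½ ^ m) (fromℕ m) ⟩
    u                             ∎

-- Only divergence is wanted, so a doubly exponential threshold does no harm. The argument
-- `suc (ℕ.pred N)` is positive even at N = 0 and equals N elsewhere.
log→∞ : (λ N → log (suc (ℕ.pred N))) →∞
log→∞ M = 2 ℕ.^ (2 ℕ.^ suc m) , λ N N≥ →
  ≤ᴿ-trans {ι M} {ι (fromℕ m)} {log (suc (ℕ.pred N))} (ι-mono (p≤∣↥p∣ M))
    (2^2^[1+m]≤n⇒m≤logn m (suc (ℕ.pred N)) (ℕ.≤-trans N≥ (n≤suc[pred[n]] N)))
  where
  m = ℤ.∣ ↥ M ∣
  n≤suc[pred[n]] : ∀ n → n ℕ.≤ suc (ℕ.pred n)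
  n≤suc[pred[n]] zero    = ℕ.z≤n
  n≤suc[pred[n]] (suc n) = ℕ.≤-refl

-- The vanishing error term.

-- For N ≥ N₀ take ε = 0; before that ε cancels the left side.
∃ε→0 : ∀ (s : ℕ → ℝ) → s →∞ → ∀ (k : ℕ → ℕ) c → (∀ N → N ℕ.≤ 2 ℕ.* (k N ℕ.+ c)) →
       ∃ λ (ε : ℕ → ℝ) → ε →0 × (∀ N → ι (+ N / 2) -ᴿ s N +ᴿ ε N ≤ᴿ ι (fromℕ (k N)))
∃ε→0 s s→∞ k c N≤ = (λ N → ε (N₀ ℕ.≤? N)) ,
  (λ δ 0<δ → N₀ , λ N N₀≤N → ε-small 0<δ (N₀ ℕ.≤? N) N₀≤N) , (λ N → bound (N₀ ℕ.≤? N))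
  where
  -- The integer k N falls short of N/2 by at most c; from N₀ on, s N is at least c and absorbs the
  -- loss.
  N₀ = proj₁ (s→∞ (fromℕ c))
  ε : ∀ {N} → Dec (N₀ ℕ.≤ N) → ℝ
  ε     (yes _) = ι 0ℚ
  ε {N} (no _)  = -ᴿ (ι (+ N / 2) -ᴿ s N)
  ε-small : ∀ {δ N} → 0ℚ < δ → (N₀≤?N : Dec (N₀ ℕ.≤ N)) → N₀ ℕ.≤ N →
            ι (- δ) ≤ᴿ ε N₀≤?N × ε N₀≤?N ≤ᴿ ι δ
  ε-small 0<δ (yes _)   _    = ι-mono (<⇒≤ (neg-antimono-< 0<δ)) , ι-mono (<⇒≤ 0<δ)
  ε-small 0<δ (no N₀≰N) N₀≤N = contradiction N₀≤N N₀≰N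
  bound : ∀ {N} (N₀≤?N : Dec (N₀ ℕ.≤ N)) → ι (+ N / 2) -ᴿ s N +ᴿ ε N₀≤?N ≤ᴿ ι (fromℕ (k N))
  bound {N} (yes N₀≤N) = ≤ᴿ-trans {ι (+ N / 2) -ᴿ s N +ᴿ ι 0ℚ} {ι (+ N / 2 - fromℕ c + 0ℚ)} {ι (fromℕ (k N))}
    (+≤ι {x = ι (+ N / 2) -ᴿ s N} {ι 0ℚ}
      (+≤ι {x = ι (+ N / 2)} { -ᴿ s N} (ι-mono ≤-refl) (-≤ι {x = s N} (proj₂ (s→∞ (fromℕ c)) N N₀≤N))) (ι-mono ≤-refl))
    (ι-mono (begin
      + N / 2 - fromℕ c + 0ℚ               ≡⟨ +-identityʳ _ ⟩
      + N / 2 - fromℕ c                    ≤⟨ +-monoˡ-≤ (- fromℕ c) (n≤2m⇒n/2≤m (N≤ N)) ⟩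
      fromℕ (k N ℕ.+ c) - fromℕ c          ≡⟨ cong (_- fromℕ c) (fromℕ-+ (k N) c) ⟩
      fromℕ (k N) + fromℕ c - fromℕ c      ≡⟨ solve 2 (λ k c → k :+ c :+ :- c := k) refl (fromℕ (k N)) (fromℕ c) ⟩
      fromℕ (k N)                          ∎))
    where open ≤-Reasoning
  bound {N} (no _) = ≤ᴿ-trans {x +ᴿ (-ᴿ x)} {ι 0ℚ} {ι (fromℕ (k N))} (x-x≤0 x) (ι-mono (fromℕ-≥0 (k N)))
    where x = ι (+ N / 2) -ᴿ s N

-- Lower bounds for the expected values.

ι≤sum : ∀ {A : Set} {X : A → ℝ} {g : A → ℕ} → (∀ a → ι (fromℕ (g a)) ≤ᴿ X a) →
        ∀ as → ι (fromℕ (sum (map g as))) ≤ᴿ foldr _+ᴿ_ (ι 0ℚ) (map X as)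
ι≤sum             g≤X []       = ι-mono ≤-refl
ι≤sum {X = X} {g} g≤X (a ∷ as) = subst (λ t → ι t ≤ᴿ X a +ᴿ foldr _+ᴿ_ (ι 0ℚ) (map X as))
  (sym (fromℕ-+ (g a) (sum (map g as))))
  (ι≤+ {x = X a} {foldr _+ᴿ_ (ι 0ℚ) (map X as)} (g≤X a) (ι≤sum g≤X as))

-- Stating the mean of g as c · 2ᴺ ≤ Σ g keeps all the counting in ℕ; the division by 2ᴺ takes place
-- only here.
ι≤𝔼 : ∀ {N c} {X : Word N → ℝ} {g : Word N → ℕ} → (∀ S → ι (fromℕ (g S)) ≤ᴿ X S) →
      c ℕ.* 2 ℕ.^ N ℕ.≤ sum (map g (words N)) → ι (fromℕ c) ≤ᴿ 𝔼 N X
ι≤𝔼 {N} {c} {X} {g} g≤X c≤ = ι≤÷ {x = total} (2 ℕ.^ N) {{ℕ.m^n≢0 2 N}}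
  (≤ᴿ-trans {ι (fromℕ c * fromℕ (2 ℕ.^ N))} {ι (fromℕ (sum (map g (words N))))} {total}
    (ι-mono (subst (_≤ fromℕ (sum (map g (words N)))) (fromℕ-* c (2 ℕ.^ N)) (fromℕ-mono c≤)))
    (ι≤sum g≤X (words N)))
  where total = foldr _+ᴿ_ (ι 0ℚ) (map X (words N))

2^⌊[N∸5]/2⌋≤Eʳᵃᵗ⁻ˢʸᵐ : ∀ N → ι (2ℚ ^ ℕ.⌊ N ℕ.∸ 5 /2⌋) ≤ᴿ Eʳᵃᵗ⁻ˢʸᵐ N
2^⌊[N∸5]/2⌋≤Eʳᵃᵗ⁻ˢʸᵐ N =
  let (g , g≤Λ , mean) = ∃minorant N k (2⌊n/2⌋≤n (N ℕ.∸ 5))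
  in subst (λ t → ι t ≤ᴿ Eʳᵃᵗ⁻ˢʸᵐ N) (fromℕ-2^ k)
       (ι≤𝔼 {c = 2 ℕ.^ k} {g = g} (λ S → ι-mono (fromℕ-mono (g≤Λ S))) mean)
  where k = ℕ.⌊ N ℕ.∸ 5 /2⌋

-- Since 2^g S is at most `Λˢʸᵐ S`, it is at most the complexity of both S and its reverse, so g S
-- lies below both logarithms and hence below their minimum.
⌊N/2⌋∸6≤E²⁻ᵃᵈⁱᶜ⁻ˢʸᵐ : ∀ N → ι (fromℕ (ℕ.⌊ N /2⌋ ℕ.∸ 6)) ≤ᴿ E²⁻ᵃᵈⁱᶜ⁻ˢʸᵐ N
⌊N/2⌋∸6≤E²⁻ᵃᵈⁱᶜ⁻ˢʸᵐ N =
  let (g , 2^g≤Λ , mean) = ∃log-minorant N ℕ.⌊ N /2⌋ (2⌊n/2⌋≤n N)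
  in ι≤𝔼 {X = λ₂ˢʸᵐ} {g} (λ S → ι≤⊓ {x = λ₂ S} {λ₂ (Vec.reverse S)}
       (2^m≤n⇒m≤log₂n (g S) (Λ S) {{Λ≢0 S}} (ℕ.≤-trans (2^g≤Λ S) (ℕ.m⊓n≤m (Λ S) _)))
       (2^m≤n⇒m≤log₂n (g S) (Λ (Vec.reverse S)) {{Λ≢0 (Vec.reverse S)}}
         (ℕ.≤-trans (2^g≤Λ S) (ℕ.m⊓n≤n (Λ S) _)))) mean

theorem2 : (∀ (r : ℕ → ℝ) → r →∞ →
    ∃ λ (ε : ℕ → ℝ) → ε →0 ×
    (∀ N .{{_ : NonTrivial N}} →
    2^ (ι (+ N / 2) -ᴿ r N +ᴿ ε N) ≤ᴿ Eʳᵃᵗ⁻ˢʸᵐ N))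
    × (∃ λ (ε : ℕ → ℝ) → ε →0 ×
    (∀ N .{{_ : NonTrivial N}} →
    ι (+ N / 2) -ᴿ log N {{nonTrivial⇒nonZero N}} +ᴿ ε N ≤ᴿ E²⁻ᵃᵈⁱᶜ⁻ˢʸᵐ N))
theorem2 = rational , 2-adic
  where
  rational : ∀ (r : ℕ → ℝ) → r →∞ → ∃ λ (ε : ℕ → ℝ) → ε →0 ×
             (∀ N .{{_ : NonTrivial N}} → 2^ (ι (+ N / 2) -ᴿ r N +ᴿ ε N) ≤ᴿ Eʳᵃᵗ⁻ˢʸᵐ N)
  rational r r→∞ =
    let (ε , ε→0 , bound) = ∃ε→0 r r→∞ (λ N → ℕ.⌊ N ℕ.∸ 5 /2⌋) 3 n≤2[⌊[n∸5]/2⌋+3]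
    in ε , ε→0 , λ N → ≤ᴿ-trans {2^ (ι (+ N / 2) -ᴿ r N +ᴿ ε N)} {ι (2ℚ ^ ℕ.⌊ N ℕ.∸ 5 /2⌋)} {Eʳᵃᵗ⁻ˢʸᵐ N}
         (2^-mono-≤ι {ι (+ N / 2) -ᴿ r N +ᴿ ε N} ℕ.⌊ N ℕ.∸ 5 /2⌋ (bound N)) (2^⌊[N∸5]/2⌋≤Eʳᵃᵗ⁻ˢʸᵐ N)
  2-adic : ∃ λ (ε : ℕ → ℝ) → ε →0 × (∀ N .{{_ : NonTrivial N}} →
           ι (+ N / 2) -ᴿ log N {{nonTrivial⇒nonZero N}} +ᴿ ε N ≤ᴿ E²⁻ᵃᵈⁱᶜ⁻ˢʸᵐ N)
  2-adic =
    let (ε , ε→0 , bound) = ∃ε→0 (λ N → log (suc (ℕ.pred N))) log→∞ (λ N → ℕ.⌊ N /2⌋ ℕ.∸ 6) 7 n≤2[⌊n/2⌋∸6+7]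
    -- Once N is a successor, `suc (ℕ.pred N)` computes to N, and the bound concerns the required
    -- log N.
    in ε , ε→0 , λ { zero {{()}} ; N@(suc n) → ≤ᴿ-trans
         {ι (+ N / 2) -ᴿ log N +ᴿ ε N} {ι (fromℕ (ℕ.⌊ N /2⌋ ℕ.∸ 6))} {E²⁻ᵃᵈⁱᶜ⁻ˢʸᵐ N}
         (bound N) (⌊N/2⌋∸6≤E²⁻ᵃᵈⁱᶜ⁻ˢʸᵐ N) }
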